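{- Let $\mathbb{F}_q$ be a finite field and $\chi$ its canonical additive character. The eigenvalues (listed with multiplicity) of the adjacency matrix of the special unit-graph on $\operatorname{Mat}_2(\mathbb{F}_q)$ are: $\lambda = q^3 - q$ with multiplicity $1$; $\mu_0 = -q$ with multiplicity $q^3+q^2-q-1$; and, for each $\delta \in \mathbb{F}_q^{\ast}$, $\mu_\delta = q\sum_{\alpha \in \mathbb{F}_q^{\ast}} \chi(\alpha + \delta\alpha^{ -1})$ with multiplicity $q^3 - q$.
   Context: The special unit-graph on $\operatorname{Mat}_2(\mathbb{F}_q)$ is the Cayley graph $\operatorname{Cay}(\operatorname{Mat}_2(\mathbb{F}_q), \operatorname{SL}_2(\mathbb{F}_q))$: vertex set $\operatorname{Mat}_2(\mathbb{F}_q)$, with $A$ adjacent to $B$ iff $\det(B-A)=1$ (this relation is symmetric for $2\times 2$ matrices). The canonical additive character of $\mathbb{F}_q$, where $q=p^m$ with $p$ prime, is $\chi(x) = \exp(2\pi i \operatorname{Tr}_{\mathbb{F}_q/\mathbb{F}_p}(x)/p)$. -}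

module Defs where

open import Level using (Level; _⊔_; suc)
open import Algebra.Bundles using (Group; Semiring; CommutativeRing)
import Algebra.Construct.DirectProduct as Product
import Algebra.Definitions.RawSemiring as RawSemiringOps
import Algebra.Properties.Group as GroupProperties
import Algebra.Properties.Ring as RingProperties
open import Data.Fin.Base using (Fin; toℕ)
open import Data.Fin.Properties using (any?; *↔×)
open import Data.List.Base using (List; length; filter; foldr; map; allFin)
open import Data.Nat.Base as ℕ using (ℕ)
open import Data.Nat.Primality using (Prime)
open import Data.Product.Base using (Σ-syntax; ∃-syntax; ∃₂; _×_; _,_)
open import Data.Product.Function.NonDependent.Setoid using (_×-inverse_)
open import Data.Product.Relation.Binary.Pointwise.NonDependent
  using (_×ₛ_; Pointwise-≡↔≡)
open import Data.Vec.Functional using (Vector)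
open import Function.Bundles using (Inverse)
import Function.Construct.Composition as Compose
import Function.Construct.Symmetry as Symmetry
open import Relation.Binary.Bundles using (Setoid)
open import Relation.Binary.Definitions
  using (Decidable; Symmetric; Irreflexive; _Respects_; _Respects₂_)
open import Relation.Binary.PropositionalEquality as ≡ using (_≡_)
open import Relation.Nullary.Decidable using (yes; no; does; ¬?)
open import Relation.Nullary.Negation using (¬_)
import Relation.Unary as Unary
open import Data.Bool.Base using (if_then_else_)

------------------------------------------------------------------------
-- Fields

-- Classical fields: equality is decidable.  The inverse is a total function;
-- its value at 0# is unspecified.

record Field c ℓ : Set (suc (c ⊔ ℓ)) where
  infix  4 _≟_
  infix  9 _⁻¹
  field
    commutativeRing : CommutativeRing c ℓ
  open CommutativeRing commutativeRing public
  field
    _≟_        : Decidable _≈_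
    1≉0        : ¬ (1# ≈ 0#)
    _⁻¹        : Carrier → Carrier
    ⁻¹-inverse : ∀ {x} → ¬ (x ≈ 0#) → x * x ⁻¹ ≈ 1#

  open RawSemiringOps (Semiring.rawSemiring semiring) public
    using (_^_; sum) renaming (_×_ to _·_)

  fromℕ : ℕ → Carrier
  fromℕ n = n · 1#

  sumOver : ∀ {a} {A : Set a} → List A → (A → Carrier) → Carrier
  sumOver xs f = foldr _+_ 0# (map f xs)

-- A finite field with q = p ^ m elements.

record FiniteField c ℓ : Set (suc (c ⊔ ℓ)) where
  field
    baseField : Field c ℓ
  open Field baseField public
  field
    p m         : ℕ
    p-prime     : Prime p
    enumeration : Inverse setoid (≡.setoid (Fin (p ℕ.^ m)))

  q : ℕ
  q = p ℕ.^ m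

  elements : List Carrier
  elements = map (Inverse.from enumeration) (allFin q)

  nonzeroElements : List Carrier
  nonzeroElements = filter (λ α → ¬? (α ≟ 0#)) elements

  Tr : Carrier → Carrier
  Tr x = sum {m} (λ j → x ^ (p ℕ.^ toℕ j))

  -- The identification of the prime subfield with {0 , … , p - 1}.  The
  -- second clause only concerns elements outside the prime subfield, so it
  -- is never reached for a trace.
  residue : Carrier → ℕ
  residue y with any? {p} (λ t → fromℕ (toℕ t) ≟ y)
  ... | yes (t , _) = toℕ t
  ... | no _        = 0

------------------------------------------------------------------------
-- The complex exponential

-- There is no library type of complex numbers.  The field ℂ is represented
-- by a field of characteristic zero with a homomorphism exp from its additive
-- to its multiplicative group whose kernel is the infinite cyclic group
-- generated by a nonzero element 2πi.  The complex numbers with the usual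
-- exp and 2πi are the intended instance.

record ComplexExponential c ℓ : Set (suc (c ⊔ ℓ)) where
  field
    baseField : Field c ℓ
  open Field baseField public
  field
    characteristicZero : ∀ n → ¬ (fromℕ (ℕ.suc n) ≈ 0#)
    exp      : Carrier → Carrier
    exp-cong : ∀ {z w} → z ≈ w → exp z ≈ exp w
    exp-0    : exp 0# ≈ 1#
    exp-+    : ∀ z w → exp (z + w) ≈ exp z * exp w
    2πi      : Carrier
    2πi≉0    : ¬ (2πi ≈ 0#)
    exp-2πi  : exp 2πi ≈ 1#
    exp-ker  : ∀ z → exp z ≈ 1# → ∃₂ λ a b → z ≈ a · 2πi - b · 2πi

-- χ(x) = exp (2πi Tr(x) / p)

canonicalCharacter :
  ∀ {a ℓ₁ c ℓ₂} (𝔽 : FiniteField a ℓ₁) (ℂ : ComplexExponential c ℓ₂) →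
  FiniteField.Carrier 𝔽 → ComplexExponential.Carrier ℂ
canonicalCharacter 𝔽 ℂ x = exp (2πi * fromℕ (residue (Tr x)) * fromℕ p ⁻¹)
  where
  open FiniteField 𝔽 using (p; Tr; residue)
  open ComplexExponential ℂ using (exp; 2πi; _*_; fromℕ; _⁻¹)

------------------------------------------------------------------------
-- Spectrum of a square matrix

module LinearAlgebra {c ℓ} (K : Field c ℓ) where
  open Field K

  SquareMatrix : ℕ → Set c
  SquareMatrix n = Fin n → Fin n → Carrier

  infix 4 _≋_
  _≋_ : ∀ {n} → Vector Carrier n → Vector Carrier n → Set ℓ
  v ≋ w = ∀ i → v i ≈ w i

  _*ᵥ_ : ∀ {n} → SquareMatrix n → Vector Carrier n → Vector Carrier n
  (A *ᵥ v) i = sum (λ j → A i j * v j)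

  linearCombination : ∀ {n d} → Vector Carrier d → (Fin d → Vector Carrier n) →
                      Vector Carrier n
  linearCombination a b i = sum (λ j → a j * b j i)

  HasDimension : ∀ {n} → (Vector Carrier n → Set ℓ) → ℕ → Set (c ⊔ ℓ)
  HasDimension {n} W d =
    Σ[ b ∈ (Fin d → Vector Carrier n) ]
      (∀ j → W (b j)) ×
      (∀ v → W v → ∃[ a ] v ≋ linearCombination a b) ×
      (∀ a → linearCombination a b ≋ (λ _ → 0#) → ∀ j → a j ≈ 0#)

  Eigenspace : ∀ {n} → SquareMatrix n → Carrier → Vector Carrier n → Set ℓ
  Eigenspace A x v = A *ᵥ v ≋ (λ i → x * v i)

  occurrences : Carrier → List Carrier → ℕ
  occurrences x xs = length (filter (x ≟_) xs)

  -- xs lists the eigenvalues of A with multiplicity.  Equal entries of xs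
  -- add up, scalars not in xs have zero eigenspace, and since xs has n
  -- entries geometric and algebraic multiplicities coincide.
  HasSpectrum : ∀ {n} → SquareMatrix n → List Carrier → Set (c ⊔ ℓ)
  HasSpectrum {n} A xs =
    length xs ≡ n × (∀ x → HasDimension (Eigenspace A x) (occurrences x xs))

------------------------------------------------------------------------
-- Finite simple graphs

record Graph v ℓ : Set (suc (v ⊔ ℓ)) where
  infix 4 _~_ _~?_
  field
    vertices    : Setoid v ℓ
    order       : ℕ
    enumeration : Inverse vertices (≡.setoid (Fin order))
  open Setoid vertices public using (_≈_) renaming (Carrier to Vertex)
  field
    _~_      : Vertex → Vertex → Set ℓ
    _~?_     : Decidable _~_
    ~-resp-≈ : _~_ Respects₂ _≈_
    ~-sym    : Symmetric _~_
    ~-irrefl : Irreflexive _≈_ _~_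

  vertex : Fin order → Vertex
  vertex = Inverse.from enumeration

adjacencyMatrix : ∀ {c ℓ v ℓ′} (K : Field c ℓ) (Γ : Graph v ℓ′) →
                  LinearAlgebra.SquareMatrix K (Graph.order Γ)
adjacencyMatrix K Γ i j = if does (vertex i ~? vertex j) then 1# else 0#
  where
  open Field K using (0#; 1#)
  open Graph Γ using (vertex; _~?_)

module _ {g ℓ} (G : Group g ℓ) where
  open Group G
  open GroupProperties G using (⁻¹-anti-homo-//)

  -- x ~ y iff y x⁻¹ ∈ S
  Cay : ∀ {n} → Inverse setoid (≡.setoid (Fin n)) →
        (S : Carrier → Set ℓ) → Unary.Decidable S → S Respects _≈_ →
        (∀ {x} → S x → S (x ⁻¹)) → ¬ S ε → Graph g ℓ
  Cay {n} enum S S? S-resp S-inv ε∉S = record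
    { vertices    = setoid
    ; order       = n
    ; enumeration = enum
    ; _~_         = λ x y → S (y // x)
    ; _~?_        = λ x y → S? (y // x)
    ; ~-resp-≈    = (λ y≈z → S-resp (∙-cong y≈z refl))
                  , (λ x≈z → S-resp (∙-cong refl (⁻¹-cong x≈z)))
    ; ~-sym       = λ {x} {y} s → S-resp (⁻¹-anti-homo-// y x) (S-inv s)
    ; ~-irrefl    = λ {x} {y} x≈y s →
        ε∉S (S-resp (trans (∙-cong (sym x≈y) refl) (inverseʳ x)) s)
    }

------------------------------------------------------------------------
-- The special unit-graph

private
  _×-enum_ : ∀ {a b ℓ₁ ℓ₂ m n} {A : Setoid a ℓ₁} {B : Setoid b ℓ₂} →
             Inverse A (≡.setoid (Fin m)) → Inverse B (≡.setoid (Fin n)) →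
             Inverse (A ×ₛ B) (≡.setoid (Fin (m ℕ.* n)))
  f ×-enum g =
    Compose.inverse (Compose.inverse (f ×-inverse g) Pointwise-≡↔≡)
                    (Symmetry.inverse *↔×)

module _ {c ℓ} (𝔽 : FiniteField c ℓ) where
  open FiniteField 𝔽
  open RingProperties ring using (-‿distribˡ-*; -‿distribʳ-*; -‿involutive)

  -- ((a , b) , (c , d)) is the matrix with rows (a , b) and (c , d).
  Mat₂ : Group c ℓ
  Mat₂ = Product.group row row
    where row = Product.group +-group +-group

  det : Group.Carrier Mat₂ → Carrier
  det ((a , b) , (c , d)) = a * d - b * c

  private
    det-cong : ∀ {X Y} → Group._≈_ Mat₂ X Y → det X ≈ det Y
    det-cong ((a , b) , (c , d)) =
      +-cong (*-cong a d) (-‿cong (*-cong b c))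

    neg*neg : ∀ x y → - x * - y ≈ x * y
    neg*neg x y = trans (sym (-‿distribˡ-* x (- y)))
      (trans (-‿cong (sym (-‿distribʳ-* x y))) (-‿involutive (x * y)))

    det-neg : ∀ X → det (Group._⁻¹ Mat₂ X) ≈ det X
    det-neg ((a , b) , (c , d)) =
      +-cong (neg*neg a d) (-‿cong (neg*neg b c))

    det-0 : det (Group.ε Mat₂) ≈ 0#
    det-0 = -‿inverseʳ (0# * 0#)

  specialUnitGraph : Graph c ℓ
  specialUnitGraph = Cay Mat₂
    ((enumeration ×-enum enumeration) ×-enum (enumeration ×-enum enumeration))
    (λ X → det X ≈ 1#)
    (λ X → det X ≟ 1#)
    (λ X≈Y → trans (sym (det-cong X≈Y)))
    (λ {X} → trans (det-neg X))
    (λ det0≈1 → 1≉0 (trans (sym det0≈1) det-0))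

{-# OPTIONS --safe #-}

-- The functions X ↦ χ⟨M,X⟩ are eigenvectors, with eigenvalues
-- Λ(M) = Σ_{det Z = 1} χ⟨M,Z⟩, and form a basis by orthogonality.  Detecting
-- det Z = δ by the character sum Σ_t χ(t(δ - det Z)) = q [det Z = δ] turns
--   q Σ_{det Z = δ} χ⟨M,Z⟩ = Σ_t χ(tδ) Σ_Z χ(- t det Z + ⟨M,Z⟩)
-- into a sum over t of products of two bilinear exponential sums, and yields
--   Σ_{det Z = δ} χ⟨M,Z⟩ = q³ [M = 0] + q Σ_{t ≠ 0} χ(tδ + det M t⁻¹).
-- At δ = 1 these are the eigenvalues, which depend only on det M for M ≠ 0;
-- at M = 0 they are the numbers of matrices of determinant δ, hence the
-- multiplicities.

module Submission where

open import Defs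
open import Data.Nat.Base using (_∸_) renaming (_+_ to _+ℕ_; _^_ to _^ℕ_)
open import Data.List.Base using (_∷_; _++_; replicate; concatMap)
open import Algebra.Bundles using (CommutativeMonoid; CommutativeRing; Group)
import Algebra.Definitions.RawMonoid as RawMonoidDefinitions
import Algebra.Properties.CommutativeMonoid.Sum as CommutativeMonoidSum
import Algebra.Properties.CommutativeSemigroup as CommutativeSemigroupProperties
import Algebra.Properties.CommutativeSemiring.Binomial as Binomial
import Algebra.Properties.CommutativeSemiring.Exp as ExpProperties
import Algebra.Properties.Group as GroupProperties
import Algebra.Properties.Ring as RingProperties
import Algebra.Properties.Semiring.Mult as MultProperties
import Algebra.Properties.Semiring.Sum as SemiringSum
import Algebra.Solver.Ring.NaturalCoefficients.Default as SemiringSolver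
open import Data.Bool.Base using (if_then_else_)
open import Data.Empty using (⊥)
open import Data.Fin.Base as Fin using (Fin; zero; suc; toℕ; inject₁; inject≤; _↑ˡ_; _↑ʳ_; combine; remQuot)
open import Data.Fin.Properties as Finₚ
  using (any?; toℕ<n; toℕ-fromℕ; toℕ-inject₁; toℕ-injective; punchInᵢ≢i; remQuot-combine)
import Data.Fin.Permutation as Perm
open import Data.List.Base using (List; []; length; filter; map; allFin; tabulate; lookup)
open import Data.List.Membership.Propositional.Properties using (∈-lookup)
open import Data.List.Properties using (length-replicate)
open import Data.List.Relation.Unary.All as All using (All; []; _∷_)
open import Data.List.Relation.Unary.All.Properties using (all-filter)
open import Data.List.Relation.Unary.AllPairs using ([]; _∷_)
open import Data.List.Relation.Unary.Unique.Propositional using (Unique)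
open import Data.List.Relation.Unary.Unique.Propositional.Properties using (allFin⁺; filter⁺)
open import Data.Nat.Base as ℕ using (ℕ; zero; suc; _!; _≤_; _<_; z≤n; s≤s)
open import Data.Nat.Combinatorics using (_C_; nCn≡1; nCk≡n!/k![n-k]!; k![n∸k]!∣n!)
open import Data.Nat.Coprimality using (prime⇒coprime; coprime-Bézout)
open import Data.Nat.Divisibility using (_∣_; divides; ∣⇒≤; m∣m*n; n∣m*n; m%n≡0⇒n∣m; ∣m+n∣m⇒∣n)
open import Data.Nat.DivMod using (_%_; _/_; m≡m%n+[m/n]*n; m%n<n; m/n*n≡m)
open import Data.Nat.GCD using (module Bézout)
open import Data.Nat.Primality using (Prime; euclidsLemma; prime⇒nonZero; prime⇒nonTrivial; ¬prime[0])
open import Data.Nat.Properties as ℕ using ()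
open import Data.Product.Base as Product using (∃-syntax; _×_; _,_; proj₁; proj₂)
open import Data.Sum.Base using (inj₁; inj₂; [_,_]′)
open import Data.Vec.Functional using (Vector)
open import Function.Base using (_∘_; id; case_of_)
open import Function.Bundles using (Inverse)
open import Level using (_⊔_)
open import Relation.Binary.Bundles using (Setoid)
open import Relation.Binary.Definitions using (Decidable)
open import Relation.Binary.PropositionalEquality as ≡ using (_≡_)
open import Relation.Nullary.Decidable using (Dec; yes; no; does; ¬?; map′; decidable-stable; _×-dec_)
open import Relation.Nullary.Negation using (¬_; contradiction)
open import Relation.Unary using (Pred)
import Relation.Unary as Unary

-- Sums over finite setoids

-- The field `ℂ` offers neither conjugation nor absolute values, so nothing here is Hermitian: a
-- dual family, with χ taken at the negated matrix, replaces the conjugate basis, and χ enters only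
-- as a nontrivial additive character. Nontriviality needs an element of nonzero trace, hence a
-- bound on the roots of polynomials, and then the kernel of `exp`. Additivity rests on traces lying
-- in the prime subfield, since `residue` takes a default value elsewhere. The second obstacle is
-- counting. `HasSpectrum` merges equal entries, and Frobenius-conjugate δ give the same μ, so
-- multiplicities cannot be matched block by block. Instead an arbitrary function g is summed over
-- the list and over all Λ(M), with equal results; indicators g then give the multiplicities and g =
-- 1 the length. These identities hold in `ℂ` and are read back in ℕ by characteristic zero. The
-- zero matrix is exceptional throughout: its determinant groups it with the eigenvalue -q, but its
-- own eigenvalue is q³ - q.

module FiniteSums {a ℓ} (M : CommutativeMonoid a ℓ) where
  open CommutativeMonoid M
  open CommutativeMonoidSum M public renaming (sum-cong-≋ to sum-cong)
  open RawMonoidDefinitions rawMonoid using () renaming (_×_ to _·_)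
  open import Relation.Binary.Reasoning.Setoid setoid

  sum-ε : ∀ {n} {t : Fin n → Carrier} → (∀ i → t i ≈ ε) → sum t ≈ ε
  sum-ε {n} t≈ε = trans (sum-cong t≈ε) (sum-replicate-zero n)

  sum-single : ∀ {n} (t : Fin n → Carrier) i → (∀ j → ¬ j ≡ i → t j ≈ ε) →
               sum t ≈ t i
  sum-single {suc n} t i t≈ε = begin
    sum t    ≈⟨ sum-remove {i = i} t ⟩
    t i ∙ _  ≈⟨ ∙-congˡ (sum-ε λ j → t≈ε _ (punchInᵢ≢i i j)) ⟩
    t i ∙ ε  ≈⟨ identityʳ (t i) ⟩
    t i      ∎

  sum-++ : ∀ m {n} (t : Fin (m ℕ.+ n) → Carrier) →
           sum t ≈ sum (t ∘ (_↑ˡ n)) ∙ sum (t ∘ (m ↑ʳ_))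
  sum-++ zero    t = sym (identityˡ _)
  sum-++ (suc m) t = trans (∙-congˡ (sum-++ m (t ∘ suc))) (sym (assoc _ _ _))

  sum-combine : ∀ m {n} (t : Fin (m ℕ.* n) → Carrier) →
                sum t ≈ sum (λ i → sum (λ j → t (combine {m} i j)))
  sum-combine zero    t = refl
  sum-combine (suc m) {n} t = trans (sum-++ n t) (∙-congˡ (sum-combine m (t ∘ (n ↑ʳ_))))

  -- The monoid stays arbitrary because the same sums serve additively in both fields and
  -- multiplicatively in `x^q≈x`.
  module Over {s r} (S : Setoid s r) {n} (e : Inverse S (≡.setoid (Fin n))) where
    private
      module S = Setoid S
      module e = Inverse e

    from-to : ∀ x → e.from (e.to x) S.≈ x
    from-to x = e.inverseʳ ≡.refl

    _≟S_ : Decidable S._≈_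
    x ≟S y = map′ (λ eq → S.trans (S.sym (from-to x)) (S.trans (e.from-cong eq) (from-to y)))
                  e.to-cong (e.to x Finₚ.≟ e.to y)

    -- Opacity lets the summand be inferred from a sum.
    opaque
      ∑ : (S.Carrier → Carrier) → Carrier
      ∑ f = sum (λ i → f (e.from i))

      ∑-sum : ∀ f → ∑ f ≡ sum (λ i → f (e.from i))
      ∑-sum f = ≡.refl

      ∑-const : ∀ x → ∑ (λ _ → x) ≈ n · x
      ∑-const x = sum-replicate n

      ∑-cong : ∀ {f g} → (∀ x → f x ≈ g x) → ∑ f ≈ ∑ g
      ∑-cong f≈g = sum-cong {n} (λ i → f≈g _)

      ∑-∙ : ∀ f g → ∑ (λ x → f x ∙ g x) ≈ ∑ f ∙ ∑ g
      ∑-∙ f g = ∑-distrib-+ (f ∘ e.from) (g ∘ e.from)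

      ∑-single : ∀ f x → (∀ {y} → y S.≈ x → f y ≈ f x) →
                 (∀ y → ¬ y S.≈ x → f y ≈ ε) → ∑ f ≈ f x
      ∑-single f x f-cong f≈ε = trans
        (sum-single _ (e.to x) λ j j≢x → f≈ε _ λ eq →
          j≢x (≡.trans (≡.sym (e.inverseˡ S.refl)) (e.to-cong eq)))
        (f-cong (from-to x))

      -- Conjugating φ with the enumeration gives a permutation of the indices.
      ∑-bijection : ∀ f → (∀ {x y} → x S.≈ y → f x ≈ f y) →
                    (φ : Inverse S S) → ∑ (f ∘ Inverse.to φ) ≈ ∑ f
      ∑-bijection f f-cong φ = sym (trans (sum-permute (f ∘ e.from) π)
        (sum-cong {n} λ i → f-cong (from-to _)))
        where
        module φ = Inverse φ
        π : Perm.Permutation n n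
        π = Perm.permutation (e.to ∘ φ.to ∘ e.from) (e.to ∘ φ.from ∘ e.from)
          (λ i → ≡.trans (e.to-cong (S.trans (φ.to-cong (from-to _)) (φ.inverseˡ S.refl)))
                         (e.inverseˡ S.refl))
          (λ i → ≡.trans (e.to-cong (S.trans (φ.from-cong (from-to _)) (φ.inverseʳ S.refl)))
                         (e.inverseˡ S.refl))

  module _ {s r s′ r′} {S : Setoid s r} {T : Setoid s′ r′} {n n′}
           (e : Inverse S (≡.setoid (Fin n))) (e′ : Inverse T (≡.setoid (Fin n′))) where
    private
      module S = Over S e
      module T = Over T e′

    opaque
      unfolding Over.∑

      ∑-swap : ∀ (f : Setoid.Carrier S → Setoid.Carrier T → Carrier) →
               S.∑ (λ x → T.∑ (λ y → f x y)) ≈ T.∑ (λ y → S.∑ (λ x → f x y))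
      ∑-swap f = ∑-comm {n} {n′} λ i j → f (Inverse.from e i) (Inverse.from e′ j)

-- Fields, finite sums and eigenvectors

lookup-injective : ∀ {a} {A : Set a} {xs : List A} → Unique xs →
                   ∀ {i j} → lookup xs i ≡ lookup xs j → i ≡ j
lookup-injective (_   ∷ _) {zero}  {zero}  _  = ≡.refl
lookup-injective (x∉ ∷ _) {zero}  {suc j} eq = contradiction eq (All.lookup x∉ (∈-lookup j))
lookup-injective (x∉ ∷ _) {suc i} {zero}  eq = contradiction (≡.sym eq) (All.lookup x∉ (∈-lookup i))
lookup-injective (_   ∷ u) {suc i} {suc j} eq = ≡.cong suc (lookup-injective u eq)

module FieldProperties {c ℓ} (K : Field c ℓ) where
  open Field K public hiding (zero)
  open RingProperties ring public
    using ( x+x≈x⇒x≈0; -‿distribˡ-*; -‿distribʳ-*; -‿involutive; -0#≈0#; x[y-z]≈xy-xz; [y-z]x≈yx-zx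
          ; +-cancelˡ; +-cancelʳ; +-inverseˡ-unique)
    renaming (x∙y⁻¹≈ε⇒x≈y to x-y≈0⇒x≈y; x≈y⇒x∙y⁻¹≈ε to x≈y⇒x-y≈0)
  open ExpProperties (CommutativeRing.commutativeSemiring commutativeRing) public
    using (^-congˡ; ^-congʳ; ^-assocʳ)
  open MultProperties semiring public
    using (×-congˡ; ×-congʳ; ×-homo-+; ×-assoc-*; ×1-homo-*)
  open FiniteSums +-commutativeMonoid public hiding (sum)
  open SemiringSum semiring public using (*-distribˡ-sum; *-distribʳ-sum)
  open import Relation.Binary.Reasoning.Setoid setoid

  *-cancelˡ-≉0 : ∀ {x y z} → ¬ x ≈ 0# → x * y ≈ x * z → y ≈ z
  *-cancelˡ-≉0 {x} {y} {z} x≉0 xy≈xz = begin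
    y               ≈⟨ drop y ⟨
    x ⁻¹ * (x * y)  ≈⟨ *-congˡ xy≈xz ⟩
    x ⁻¹ * (x * z)  ≈⟨ drop z ⟩
    z               ∎
    where
    drop : ∀ w → x ⁻¹ * (x * w) ≈ w
    drop w = begin
      x ⁻¹ * (x * w)  ≈⟨ *-assoc _ _ _ ⟨
      x ⁻¹ * x * w    ≈⟨ *-congʳ (trans (*-comm _ _) (⁻¹-inverse x≉0)) ⟩
      1# * w          ≈⟨ *-identityˡ w ⟩
      w               ∎

  x*y≈0⇒y≈0 : ∀ {x y} → ¬ x ≈ 0# → x * y ≈ 0# → y ≈ 0#
  x*y≈0⇒y≈0 {x} x≉0 xy≈0 = *-cancelˡ-≉0 x≉0 (trans xy≈0 (sym (zeroʳ x)))

  *-≉0 : ∀ {x y} → ¬ x ≈ 0# → ¬ y ≈ 0# → ¬ x * y ≈ 0#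
  *-≉0 x≉0 y≉0 = y≉0 ∘ x*y≈0⇒y≈0 x≉0

  ^-≉0 : ∀ {x} n → ¬ x ≈ 0# → ¬ x ^ n ≈ 0#
  ^-≉0 zero    x≉0 = 1≉0
  ^-≉0 (suc n) x≉0 = *-≉0 x≉0 (^-≉0 n x≉0)

  fromℕ-^ : ∀ m n → fromℕ (m ℕ.^ n) ≈ fromℕ m ^ n
  fromℕ-^ m zero    = +-identityʳ 1#
  fromℕ-^ m (suc n) = trans (×1-homo-* m (m ℕ.^ n)) (*-congˡ (fromℕ-^ m n))

  fromℕ-∣ : ∀ {d n} → d ∣ n → fromℕ d ≈ 0# → fromℕ n ≈ 0#
  fromℕ-∣ {d} (divides k ≡.refl) d≈0 =
    trans (×1-homo-* k d) (trans (*-congˡ d≈0) (zeroʳ _))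

  -- The bracket of the overview, valued in the field so that counts and sums mix. Its form makes
  -- the entries of `adjacencyMatrix` indicators by computation.
  𝟙 : ∀ {p} {P : Set p} → Dec P → Carrier
  𝟙 P? = if does P? then 1# else 0#

  𝟙-yes : ∀ {p} {P : Set p} (P? : Dec P) → P → 𝟙 P? ≈ 1#
  𝟙-yes (yes _) _ = refl
  𝟙-yes (no ¬p) p = contradiction p ¬p

  𝟙-no : ∀ {p} {P : Set p} (P? : Dec P) → ¬ P → 𝟙 P? ≈ 0#
  𝟙-no (yes p) ¬p = contradiction p ¬p
  𝟙-no (no _)  _  = refl

  𝟙-⇔ : ∀ {p q} {P : Set p} {Q : Set q} (P? : Dec P) (Q? : Dec Q) →
        (P → Q) → (Q → P) → 𝟙 P? ≈ 𝟙 Q?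
  𝟙-⇔ (yes p) Q? f g = sym (𝟙-yes Q? (f p))
  𝟙-⇔ (no ¬p) Q? f g = sym (𝟙-no Q? (¬p ∘ g))

  𝟙-× : ∀ {p q r} {P : Set p} {Q : Set q} {R : Set r}
        (P? : Dec P) (Q? : Dec Q) (R? : Dec R) → (P → Q → R) → (R → P × Q) →
        𝟙 P? * 𝟙 Q? ≈ 𝟙 R?
  𝟙-× (no ¬p) Q?      R? f g = trans (zeroˡ _) (sym (𝟙-no R? (¬p ∘ proj₁ ∘ g)))
  𝟙-× (yes p) (no ¬q) R? f g = trans (zeroʳ _) (sym (𝟙-no R? (¬q ∘ proj₂ ∘ g)))
  𝟙-× (yes p) (yes q) R? f g = trans (*-identityˡ 1#) (sym (𝟙-yes R? (f p q)))

  𝟙-*-congˡ : ∀ {p} {P : Set p} (P? : Dec P) {x y} → (P → x ≈ y) → 𝟙 P? * x ≈ 𝟙 P? * y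
  𝟙-*-congˡ (yes p) x≈y = *-congˡ (x≈y p)
  𝟙-*-congˡ (no _)  x≈y = trans (zeroˡ _) (sym (zeroˡ _))

  𝟙* : ∀ {p} {P : Set p} (P? : Dec P) {x y} → (P → x ≈ y) → (¬ P → y ≈ 0#) → 𝟙 P? * x ≈ y
  𝟙* (yes p) x≈y _   = trans (*-identityˡ _) (x≈y p)
  𝟙* (no ¬p) _   y≈0 = trans (zeroˡ _) (sym (y≈0 ¬p))

  module _ {a} {A : Set a} where

    sumOver-cong : ∀ (xs : List A) {f g} → (∀ x → f x ≈ g x) →
                   sumOver xs f ≈ sumOver xs g
    sumOver-cong []       f≈g = refl
    sumOver-cong (x ∷ xs) f≈g = +-cong (f≈g x) (sumOver-cong xs f≈g)

    sumOver-All : ∀ {p} {P : Pred A p} {xs} {f g} → All P xs → (∀ {x} → P x → f x ≈ g x) →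
                   sumOver xs f ≈ sumOver xs g
    sumOver-All []       f≈g = refl
    sumOver-All (p ∷ ps) f≈g = +-cong (f≈g p) (sumOver-All ps f≈g)

    sumOver-++ : ∀ (xs ys : List A) f →
                 sumOver (xs ++ ys) f ≈ sumOver xs f + sumOver ys f
    sumOver-++ []       ys f = sym (+-identityˡ _)
    sumOver-++ (x ∷ xs) ys f = trans (+-congˡ (sumOver-++ xs ys f)) (sym (+-assoc _ _ _))

    sumOver-*ˡ : ∀ (xs : List A) y f → y * sumOver xs f ≈ sumOver xs (λ x → y * f x)
    sumOver-*ˡ []       y f = zeroʳ y
    sumOver-*ˡ (x ∷ xs) y f = trans (distribˡ _ _ _) (+-congˡ (sumOver-*ˡ xs y f))

    sumOver-replicate : ∀ n (x : A) f → sumOver (replicate n x) f ≈ fromℕ n * f x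
    sumOver-replicate zero    x f = sym (zeroˡ _)
    sumOver-replicate (suc n) x f = begin
      f x + sumOver (replicate n x) f  ≈⟨ +-cong (sym (*-identityˡ _)) (sumOver-replicate n x f) ⟩
      1# * f x + fromℕ n * f x         ≈⟨ distribʳ _ _ _ ⟨
      fromℕ (suc n) * f x              ∎

    sumOver-concatMap : ∀ {b} {B : Set b} (g : B → List A) ys f →
                        sumOver (concatMap g ys) f ≈ sumOver ys (λ y → sumOver (g y) f)
    sumOver-concatMap g []       f = refl
    sumOver-concatMap g (y ∷ ys) f =
      trans (sumOver-++ (g y) _ f) (+-congˡ (sumOver-concatMap g ys f))

    sumOver-filter : ∀ {p} {P : Pred A p} (P? : Unary.Decidable P) xs f →
                     sumOver (filter P? xs) f ≈ sumOver xs (λ x → 𝟙 (P? x) * f x)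
    sumOver-filter P? []       f = refl
    sumOver-filter P? (x ∷ xs) f with P? x
    ... | yes _ = +-cong (sym (*-identityˡ _)) (sumOver-filter P? xs f)
    ... | no _  = trans (sumOver-filter P? xs f)
                        (trans (sym (+-identityˡ _)) (+-congʳ (sym (zeroˡ _))))

    sumOver-map : ∀ {b} {B : Set b} (g : B → A) ys f →
                  sumOver (map g ys) f ≈ sumOver ys (f ∘ g)
    sumOver-map g []       f = refl
    sumOver-map g (y ∷ ys) f = +-congˡ (sumOver-map g ys f)

    sumOver-tabulate : ∀ {n} (g : Fin n → A) f → sumOver (tabulate g) f ≈ sum (f ∘ g)
    sumOver-tabulate {zero}  g f = refl
    sumOver-tabulate {suc n} g f = +-congˡ (sumOver-tabulate (g ∘ suc) f)

    sum-lookup : ∀ (xs : List A) f → sum (λ j → f (lookup xs j)) ≈ sumOver xs f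
    sum-lookup []       f = refl
    sum-lookup (x ∷ xs) f = +-congˡ (sum-lookup xs f)

    fromℕ-length : ∀ (xs : List A) → fromℕ (length xs) ≈ sumOver xs (λ _ → 1#)
    fromℕ-length []       = refl
    fromℕ-length (x ∷ xs) = +-congˡ (fromℕ-length xs)

  sum-filter-allFin : ∀ {n p} {P : Pred (Fin n) p} (P? : Unary.Decidable P) f →
                      sumOver (filter P? (allFin n)) f ≈ sum (λ i → 𝟙 (P? i) * f i)
  sum-filter-allFin {n} P? f =
    trans (sumOver-filter P? (allFin n) f) (sumOver-tabulate {n = n} id _)

  module CharacteristicZero (char0 : ∀ n → ¬ fromℕ (suc n) ≈ 0#) where

    -- This lets every count of the proof be carried out in the field and read back in ℕ.
    fromℕ-injective : ∀ m n → fromℕ m ≈ fromℕ n → m ≡ n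
    fromℕ-injective zero    zero    eq = ≡.refl
    fromℕ-injective zero    (suc n) eq = contradiction (sym eq) (char0 n)
    fromℕ-injective (suc m) zero    eq = contradiction eq (char0 m)
    fromℕ-injective (suc m) (suc n) eq = ≡.cong suc (fromℕ-injective m n (+-cancelˡ 1# _ _ eq))

-- Eigenspaces from an eigenbasis, and bases from dual families

module _ {c ℓ} (K : Field c ℓ) where
  open FieldProperties K
  open LinearAlgebra K
  open import Relation.Binary.Reasoning.Setoid setoid

  module Eigenbasis {n} (A : SquareMatrix n) (κ : Fin n → Carrier) (b : Fin n → Vector Carrier n)
    (eigen : ∀ j → Eigenspace A (κ j) (b j))
    (span  : ∀ v → ∃[ a ] v ≋ linearCombination a b)
    (indep : ∀ a → linearCombination a b ≋ (λ _ → 0#) → ∀ j → a j ≈ 0#)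
    where

    A*combination : ∀ a i → (A *ᵥ linearCombination a b) i ≈ sum (λ j → κ j * a j * b j i)
    A*combination a i = begin
      sum (λ k → A i k * sum (λ j → a j * b j k))
        ≈⟨ sum-cong {n} (λ k → *-distribˡ-sum {n} (A i k) _) ⟩
      sum (λ k → sum (λ j → A i k * (a j * b j k)))
        ≈⟨ ∑-comm {n} {n} (λ k j → A i k * (a j * b j k)) ⟩
      sum (λ j → sum (λ k → A i k * (a j * b j k)))
        ≈⟨ sum-cong {n} (λ j → sum-cong {n} λ k → x∙yz≈y∙xz (A i k) (a j) (b j k)) ⟩
      sum (λ j → sum (λ k → a j * (A i k * b j k)))
        ≈⟨ sum-cong {n} (λ j → *-distribˡ-sum {n} (a j) _) ⟨
      sum (λ j → a j * sum (λ k → A i k * b j k))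
        ≈⟨ sum-cong {n} (λ j → *-congˡ (eigen j i)) ⟩
      sum (λ j → a j * (κ j * b j i))
        ≈⟨ sum-cong {n} (λ j → x∙yz≈yx∙z (a j) (κ j) (b j i)) ⟩
      sum (λ j → κ j * a j * b j i) ∎
      where
      open import Algebra.Properties.CommutativeSemigroup *-commutativeSemigroup

    -- Applying A - x to v multiplies the j-th coordinate by `κ j - x`. The result is zero, so
    -- independence kills each of these products.
    coordinate-eigen : ∀ {x v} a → v ≋ linearCombination a b → Eigenspace A x v →
                       ∀ j → ¬ x ≈ κ j → a j ≈ 0#
    coordinate-eigen {x} {v} a v≋ Av≋xv j x≉κ =
      x*y≈0⇒y≈0 (λ eq → x≉κ (sym (x-y≈0⇒x≈y _ _ eq)))
        (indep (λ j → (κ j - x) * a j) vanishes j)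
      where
      vanishes : linearCombination (λ j → (κ j - x) * a j) b ≋ (λ _ → 0#)
      -- Adding `x * v i` to both sides turns Av - xv into Av, to which `A*combination` applies.
      vanishes i = +-cancelˡ (x * v i) _ _ (begin
        x * v i + sum (λ j → (κ j - x) * a j * b j i)
          ≈⟨ +-congʳ (trans (*-congˡ (v≋ i)) (*-distribˡ-sum {n} x _)) ⟩
        sum (λ j → x * (a j * b j i)) + sum (λ j → (κ j - x) * a j * b j i)
          ≈⟨ ∑-distrib-+ {n} _ _ ⟨
        sum (λ j → x * (a j * b j i) + (κ j - x) * a j * b j i)
          ≈⟨ sum-cong {n} (λ j → combine-terms (κ j) (a j) (b j i)) ⟩
        sum (λ j → κ j * a j * b j i)
          ≈⟨ A*combination a i ⟨
        (A *ᵥ linearCombination a b) i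
          ≈⟨ sum-cong {n} (λ k → *-congˡ (v≋ k)) ⟨
        (A *ᵥ v) i
          ≈⟨ Av≋xv i ⟩
        x * v i
          ≈⟨ +-identityʳ _ ⟨
        x * v i + 0# ∎)
        where
        combine-terms : ∀ k a b → x * (a * b) + (k - x) * a * b ≈ k * a * b
        combine-terms k a b = begin
          x * (a * b) + (k - x) * a * b    ≈⟨ +-congˡ (*-assoc _ _ _) ⟩
          x * (a * b) + (k - x) * (a * b)  ≈⟨ distribʳ _ _ _ ⟨
          (x + (k - x)) * (a * b)          ≈⟨ *-congʳ (trans (+-comm _ _) (trans (+-assoc _ _ _)
                                                (trans (+-congˡ (-‿inverseˡ x)) (+-identityʳ k)))) ⟩
          k * (a * b)                      ≈⟨ *-assoc _ _ _ ⟨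
          k * a * b                        ∎

    -- The basis vectors with eigenvalue x suffice, because all other coordinates of an eigenvector
    -- vanish.
    eigenspace-dimension : ∀ x → HasDimension (Eigenspace A x)
                                   (length (filter (λ j → x ≟ κ j) (allFin n)))
    eigenspace-dimension x = b ∘ lookup L , inEigenspace , spanning , independent
      where
      L : List (Fin n)
      L = filter (λ j → x ≟ κ j) (allFin n)

      inEigenspace : ∀ j → Eigenspace A x (b (lookup L j))
      inEigenspace j i = trans (eigen _ i)
        (*-congʳ (sym (All.lookup (all-filter (λ j → x ≟ κ j) (allFin n)) (∈-lookup j))))

      spanning : ∀ v → Eigenspace A x v → ∃[ a ] v ≋ linearCombination a (b ∘ lookup L)
      spanning v Av≋xv with span v
      ... | a , v≋ = a ∘ lookup L , λ i → begin
        v i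
          ≈⟨ v≋ i ⟩
        sum (λ j → a j * b j i)
          ≈⟨ sum-cong {n} (λ j → 𝟙* (x ≟ κ j) (λ _ → refl) (λ x≉κ →
               trans (*-congʳ (coordinate-eigen a v≋ Av≋xv j x≉κ)) (zeroˡ _))) ⟨
        sum (λ j → 𝟙 (x ≟ κ j) * (a j * b j i))
          ≈⟨ sum-filter-allFin (λ j → x ≟ κ j) _ ⟨
        sumOver L (λ j → a j * b j i)
          ≈⟨ sum-lookup L (λ j → a j * b j i) ⟨
        sum (λ j → a (lookup L j) * b (lookup L j) i) ∎

      independent : ∀ a → linearCombination a (b ∘ lookup L) ≋ (λ _ → 0#) → ∀ j → a j ≈ 0#
      independent a combination≋0 j = trans (sym (trans
          (sum-single _ j λ k k≢j → trans
            (*-congʳ (𝟙-no (lookup L k Finₚ.≟ lookup L j)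
              (k≢j ∘ lookup-injective (filter⁺ (λ j → x ≟ κ j) (allFin⁺ n)))))
            (zeroˡ _))
          (trans (*-congʳ (𝟙-yes (lookup L j Finₚ.≟ lookup L j) ≡.refl)) (*-identityˡ _))))
        (indep ã (λ i → trans (extended i) (combination≋0 i)) (lookup L j))
        where
        d = length L
        ã : Fin n → Carrier
        -- The extension of a by zero outside L. As L has no repetitions, its value at `lookup L j`
        -- is the single term `a j`.
        ã k = sum (λ j → 𝟙 (lookup L j Finₚ.≟ k) * a j)
        extended : linearCombination ã b ≋ linearCombination a (b ∘ lookup L)
        extended i = begin
          sum (λ k → ã k * b k i)
            ≈⟨ sum-cong {n} (λ k → *-distribʳ-sum {d} (b k i) _) ⟩
          sum (λ k → sum (λ j → 𝟙 (lookup L j Finₚ.≟ k) * a j * b k i))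
            ≈⟨ ∑-comm {n} {d} _ ⟩
          sum (λ j → sum (λ k → 𝟙 (lookup L j Finₚ.≟ k) * a j * b k i))
            ≈⟨ sum-cong {d} (λ j → trans
                 (sum-single {n} _ (lookup L j) λ k k≢ → trans
                   (*-congʳ (trans (*-congʳ (𝟙-no (lookup L j Finₚ.≟ k) (k≢ ∘ ≡.sym))) (zeroˡ _)))
                   (zeroˡ _))
                 (*-congʳ (trans (*-congʳ (𝟙-yes (lookup L j Finₚ.≟ lookup L j) ≡.refl)) (*-identityˡ _)))) ⟩
          sum (λ j → a j * b (lookup L j) i) ∎

  -- With B and B* the matrices of the two families, `rows` reads B B*ᵀ = C and `columns` reads Bᵀ
  -- B* = C, with C a scalar matrix.
  module DualBases {n} (b b* : Fin n → Vector Carrier n) {C} (C≉0 : ¬ C ≈ 0#)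
    (rows    : ∀ j k → sum (λ i → b j i * b* k i) ≈ C * 𝟙 (j Finₚ.≟ k))
    (columns : ∀ i k → sum (λ j → b j i * b* j k) ≈ C * 𝟙 (i Finₚ.≟ k))
    where

    private
      sum-δ : ∀ (v δ : Vector Carrier n) i → (∀ k → δ k ≈ C * 𝟙 (k Finₚ.≟ i)) →
              sum (λ k → v k * δ k) ≈ C * v i
      sum-δ v δ i δ≈ = begin
        sum (λ k → v k * δ k)
          ≈⟨ sum-single {n} _ i (λ k k≢i → trans (*-congˡ (trans (δ≈ k)
               (trans (*-congˡ (𝟙-no (k Finₚ.≟ i) k≢i)) (zeroʳ C)))) (zeroʳ _)) ⟩
        v i * δ i
          ≈⟨ *-congˡ (trans (δ≈ i) (trans (*-congˡ (𝟙-yes (i Finₚ.≟ i) ≡.refl)) (*-identityʳ C))) ⟩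
        v i * C
          ≈⟨ *-comm _ _ ⟩
        C * v i ∎

      sum-assoc : ∀ (v : Vector Carrier n) (s : Fin n → Vector Carrier n) (t : Vector Carrier n) →
                  sum (λ j → sum (λ k → v k * s k j) * t j) ≈ sum (λ k → v k * sum (λ j → s k j * t j))
      sum-assoc v s t = begin
        sum (λ j → sum (λ k → v k * s k j) * t j)
          ≈⟨ sum-cong {n} (λ j → *-distribʳ-sum {n} (t j) _) ⟩
        sum (λ j → sum (λ k → v k * s k j * t j))
          ≈⟨ ∑-comm {n} {n} _ ⟩
        sum (λ k → sum (λ j → v k * s k j * t j))
          ≈⟨ sum-cong {n} (λ k → trans (sum-cong {n} λ j → *-assoc (v k) (s k j) (t j))
                                       (sym (*-distribˡ-sum {n} (v k) _))) ⟩
        sum (λ k → v k * sum (λ j → s k j * t j)) ∎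

    -- Pairing the combination with `b* k` isolates `C * a k`.
    independent : ∀ a → linearCombination a b ≋ (λ _ → 0#) → ∀ j → a j ≈ 0#
    independent a combination≋0 k = x*y≈0⇒y≈0 C≉0 (begin
      C * a k
        ≈⟨ sum-δ a _ k (λ j → rows j k) ⟨
      sum (λ j → a j * sum (λ i → b j i * b* k i))
        ≈⟨ sum-assoc a b (b* k) ⟨
      sum (λ i → sum (λ j → a j * b j i) * b* k i)
        ≈⟨ sum-ε {n} (λ i → trans (*-congʳ (combination≋0 i)) (zeroˡ _)) ⟩
      0# ∎)

    -- Fourier inversion: the coefficients are the pairings of v with the dual family, divided by C.
    spanning : ∀ v → ∃[ a ] v ≋ linearCombination a b
    spanning v = (λ j → C ⁻¹ * sum (λ k → v k * b* j k)) , λ i → sym (begin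
      sum (λ j → C ⁻¹ * sum (λ k → v k * b* j k) * b j i)
        ≈⟨ trans (sum-cong {n} λ j → *-assoc _ _ _) (sym (*-distribˡ-sum {n} (C ⁻¹) _)) ⟩
      C ⁻¹ * sum (λ j → sum (λ k → v k * b* j k) * b j i)
        ≈⟨ *-congˡ (sum-assoc v (λ k j → b* j k) (λ j → b j i)) ⟩
      C ⁻¹ * sum (λ k → v k * sum (λ j → b* j k * b j i))
        ≈⟨ *-congˡ (sum-δ v _ i λ k → trans (sum-cong {n} λ j → *-comm _ _)
             (trans (columns i k) (*-congˡ (𝟙-⇔ (i Finₚ.≟ k) (k Finₚ.≟ i) ≡.sym ≡.sym)))) ⟩
      C ⁻¹ * (C * v i)
        ≈⟨ *-assoc _ _ _ ⟨
      C ⁻¹ * C * v i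
        ≈⟨ *-congʳ (trans (*-comm _ _) (⁻¹-inverse C≉0)) ⟩
      1# * v i
        ≈⟨ *-identityˡ _ ⟩
      v i ∎)

-- Finite fields and the trace

prime∣n!⇒p≤n : ∀ {p} → Prime p → ∀ n → p ∣ n ! → p ≤ n
prime∣n!⇒p≤n p-prime zero    p∣1  = contradiction (∣⇒≤ p∣1)
  (ℕ.<⇒≱ (ℕ.nonTrivial⇒n>1 _ {{prime⇒nonTrivial p-prime}}))
prime∣n!⇒p≤n p-prime (suc n) p∣n! with euclidsLemma (suc n) (n !) p-prime p∣n!
... | inj₁ p∣1+n = ∣⇒≤ p∣1+n
... | inj₂ p∣n!′ = ℕ.m≤n⇒m≤1+n (prime∣n!⇒p≤n p-prime n p∣n!′)

n∣n! : ∀ n .{{_ : ℕ.NonZero n}} → n ∣ n !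
n∣n! (suc n) = m∣m*n (n !)

-- The prime divides p! = (p C k) k! (p - k)!, but neither of the two smaller factorials.
prime∣C : ∀ {p k} → Prime p → 0 < k → k < p → p ∣ p C k
prime∣C {p} {k} p-prime 0<k k<p =
  case euclidsLemma (p C k) (k ! ℕ.* (p ∸ k) !) p-prime p∣product of λ where
    (inj₁ p∣C) → p∣C
    (inj₂ p∣k!*l!) → case euclidsLemma (k !) ((p ∸ k) !) p-prime p∣k!*l! of λ where
      (inj₁ p∣k!) → contradiction (prime∣n!⇒p≤n p-prime k p∣k!) (ℕ.<⇒≱ k<p)
      (inj₂ p∣l!) → contradiction (prime∣n!⇒p≤n p-prime (p ∸ k) p∣l!)
                      (ℕ.<⇒≱ (ℕ.∸-monoʳ-< 0<k (ℕ.<⇒≤ k<p)))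
  where
  instance
    _ = prime⇒nonZero p-prime
    k!*l!≢0 = k ℕ.!* (p ∸ k) !≢0
  p∣product : p ∣ (p C k) ℕ.* (k ! ℕ.* (p ∸ k) !)
  p∣product = ≡.subst (p ∣_) (≡.sym (≡.trans
    (≡.cong (ℕ._* (k ! ℕ.* (p ∸ k) !)) (nCk≡n!/k![n-k]! (ℕ.<⇒≤ k<p)))
    (m/n*n≡m (k![n∸k]!∣n! (ℕ.<⇒≤ k<p))))) (n∣n! p)

translation : ∀ {g ℓ} (G : Group g ℓ) → Group.Carrier G → Inverse (Group.setoid G) (Group.setoid G)
translation G g = record
  { to        = _∙ g
  ; from      = _∙ g ⁻¹
  ; to-cong   = ∙-congʳ
  ; from-cong = ∙-congʳ
  ; inverse   = (λ eq → trans (∙-congʳ eq) (//-rightDividesˡ g _))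
              , (λ eq → trans (∙-congʳ eq) (//-rightDividesʳ g _))
  }
  where
  open Group G
  open GroupProperties G

-- Monic polynomials and the bound on their roots

module MonicPolynomials {c ℓ} (K : Field c ℓ) where
  open FieldProperties K
  open SemiringSolver (CommutativeRing.commutativeSemiring commutativeRing)

  -- The list c₀ ∷ … ∷ c₍ₙ₋₁₎ ∷ [] stands for c₀ + … + c₍ₙ₋₁₎ xⁿ⁻¹ + xⁿ.
  monic : List Carrier → Carrier → Carrier
  monic []       x = 1#
  monic (c ∷ cs) x = c + x * monic cs x

  -- Synthetic division by x - r; the constant coefficient plays no role in
  -- the quotient and is left out.
  quotient : Carrier → List Carrier → List Carrier
  quotient r []       = []
  quotient r (c ∷ cs) = monic (c ∷ cs) r ∷ quotient r cs

  length-quotient : ∀ r cs → length (quotient r cs) ≡ length cs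
  length-quotient r []       = ≡.refl
  length-quotient r (c ∷ cs) = ≡.cong suc (length-quotient r cs)

  monic-cong : ∀ cs {x y} → x ≈ y → monic cs x ≈ monic cs y
  monic-cong []       x≈y = refl
  monic-cong (c ∷ cs) x≈y = +-congˡ (*-cong x≈y (monic-cong cs x≈y))

  -- Division with remainder at x = r + h; naming the difference h keeps subtraction out, so the
  -- semiring solver applies.
  monic-quotient : ∀ r h c cs →
    monic (c ∷ cs) (r + h) ≈ monic (c ∷ cs) r + h * monic (quotient r cs) (r + h)
  monic-quotient r h c [] =
    solve 3 (λ r h c → c :+ (r :+ h) :* con 1 := c :+ r :* con 1 :+ h :* con 1) refl r h c
  monic-quotient r h c (c′ ∷ cs) = trans
    (+-congˡ (*-congˡ (monic-quotient r h c′ cs)))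
    (solve 5 (λ r h c P Q → c :+ (r :+ h) :* (P :+ h :* Q) :=
                            c :+ r :* P :+ h :* (P :+ (r :+ h) :* Q))
      refl r h c (monic (c′ ∷ cs) r) (monic (quotient r cs) (r + h)))

  -- Dividing by X - `ρ zero` keeps the other roots, whose differences from it are invertible, and
  -- lowers the degree; degree zero leaves the constant 1. The bound is used for X^p - X and for the
  -- trace polynomial.
  too-many-roots : ∀ n cs → length cs ≡ n → (ρ : Fin (suc n) → Carrier) →
                   (∀ {i j} → ρ i ≈ ρ j → i ≡ j) → (∀ i → monic cs (ρ i) ≈ 0#) → ⊥
  too-many-roots zero    []       _      ρ _     root = 1≉0 (root zero)
  too-many-roots (suc n) (c ∷ cs) length≡ ρ ρ-inj root =
    too-many-roots n (quotient r cs)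
      (≡.trans (length-quotient r cs) (ℕ.suc-injective length≡))
      (ρ ∘ suc) (Finₚ.suc-injective ∘ ρ-inj) root′
    where
    r = ρ zero
    root′ : ∀ i → monic (quotient r cs) (ρ (suc i)) ≈ 0#
    root′ i = x*y≈0⇒y≈0 (λ h≈0 → case ρ-inj (x-y≈0⇒x≈y _ _ h≈0) of λ ()) (begin
      h * monic (quotient r cs) (ρ (suc i))
        ≈⟨ *-congˡ (monic-cong (quotient r cs) r+h≈) ⟨
      h * monic (quotient r cs) (r + h)
        ≈⟨ +-identityˡ _ ⟨
      0# + h * monic (quotient r cs) (r + h)
        ≈⟨ +-congʳ (root zero) ⟨
      monic (c ∷ cs) r + h * monic (quotient r cs) (r + h)
        ≈⟨ monic-quotient r h c cs ⟨
      monic (c ∷ cs) (r + h)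
        ≈⟨ monic-cong (c ∷ cs) r+h≈ ⟩
      monic (c ∷ cs) (ρ (suc i))
        ≈⟨ root (suc i) ⟩
      0# ∎)
      where
      open import Relation.Binary.Reasoning.Setoid setoid
      h = ρ (suc i) - r
      r+h≈ : r + h ≈ ρ (suc i)
      r+h≈ = trans (+-comm _ _) (GroupProperties.//-rightDividesˡ +-group r (ρ (suc i)))

  monic-power : ∀ n x → monic (replicate n 0#) x ≈ x ^ n
  monic-power zero    x = refl
  monic-power (suc n) x = trans (+-identityˡ _) (*-congˡ (monic-power n x))

  -- Adds X^n to a monic polynomial of smaller degree: its implicit leading 1 has to become an
  -- explicit coefficient, followed by zeros up to the new degree.
  addPower : List Carrier → ℕ → List Carrier
  addPower cs       zero    = []
  addPower []       (suc n) = 1# ∷ replicate n 0#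
  addPower (c ∷ cs) (suc n) = c ∷ addPower cs n

  length-addPower : ∀ cs n → length (addPower cs n) ≡ n
  length-addPower cs       zero    = ≡.refl
  length-addPower []       (suc n) = ≡.cong suc (length-replicate n)
  length-addPower (c ∷ cs) (suc n) = ≡.cong suc (length-addPower cs n)

  monic-addPower : ∀ cs {n} → length cs < n → ∀ x →
                   monic (addPower cs n) x ≈ monic cs x + x ^ n
  monic-addPower []       {suc n} _         x = +-congˡ (*-congˡ (monic-power n x))
  monic-addPower (c ∷ cs) {suc n} (s≤s lt) x = trans
    (+-congˡ (*-congˡ (monic-addPower cs lt x)))
    (solve 4 (λ c x P X → c :+ x :* (P :+ X) := c :+ x :* P :+ x :* X) refl c x (monic cs x) (x ^ n))

-- Characteristic, Frobenius map and prime subfield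

module FiniteFieldProperties {c ℓ} (𝔽 : FiniteField c ℓ) where
  open FiniteField 𝔽 using (baseField; p; m; q; p-prime; enumeration; Tr; residue)
  open FieldProperties baseField
  open MonicPolynomials baseField
  open import Relation.Binary.Reasoning.Setoid setoid
  private
    module ∏ = FiniteSums *-commutativeMonoid
    module ∑F = Over setoid enumeration
    module ∏F = ∏.Over setoid enumeration

    instance
      p≢0 : ℕ.NonZero p
      p≢0 = prime⇒nonZero p-prime

  1<p : 1 < p
  1<p = ℕ.nonTrivial⇒n>1 p {{prime⇒nonTrivial p-prime}}

  q>0 : 0 < q
  q>0 = ℕ.>-nonZero⁻¹ q {{ℕ.m^n≢0 p m}}

  0^q≈0 : 0# ^ q ≈ 0#
  0^q≈0 with suc n ← q | _ ← q>0 = zeroˡ _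

  -- Translation by 1 permutes the field, so adding 1 to each of the q elements leaves their sum
  -- unchanged.
  fromℕ-q≈0 : fromℕ q ≈ 0#
  fromℕ-q≈0 = +-cancelˡ (∑F.∑ id) _ _ (begin
    ∑F.∑ id + fromℕ q          ≈⟨ +-congˡ (∑F.∑-const 1#) ⟨
    ∑F.∑ id + ∑F.∑ (λ _ → 1#)  ≈⟨ ∑F.∑-∙ id (λ _ → 1#) ⟨
    ∑F.∑ (_+ 1#)               ≈⟨ ∑F.∑-bijection id id (translation +-group 1#) ⟩
    ∑F.∑ id                    ≈⟨ +-identityʳ _ ⟨
    ∑F.∑ id + 0#               ∎)

  fromℕ-p≈0 : fromℕ p ≈ 0#
  fromℕ-p≈0 = decidable-stable (fromℕ p ≟ 0#) λ p≉0 →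
    ^-≉0 m p≉0 (trans (sym (fromℕ-^ p m)) fromℕ-q≈0)

  scaling : ∀ {x} → ¬ x ≈ 0# → Inverse setoid setoid
  scaling {x} x≉0 = record
    { to        = x *_
    ; from      = x ⁻¹ *_
    ; to-cong   = *-congˡ
    ; from-cong = *-congˡ
    ; inverse   = (λ eq → trans (*-congˡ eq) (cancel _ (⁻¹-inverse x≉0)))
                , (λ eq → trans (*-congˡ eq) (cancel _ (trans (*-comm _ _) (⁻¹-inverse x≉0))))
    }
    where
    cancel : ∀ {u v} z → u * v ≈ 1# → u * (v * z) ≈ z
    cancel z uv≈1 = trans (sym (*-assoc _ _ _)) (trans (*-congʳ uv≈1) (*-identityˡ z))

  -- Multiplication by x permutes the nonzero elements, so x^(q-1) times
  -- their product is their product.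
  x^q≈x : ∀ x → x ^ q ≈ x
  x^q≈x x with x ≟ 0#
  ... | yes x≈0 = trans (^-congˡ q x≈0) (trans 0^q≈0 (sym x≈0))
  ... | no x≉0 = begin
    x ^ q                  ≈⟨ ∏F.∑-const x ⟨
    ∏F.∑ (λ _ → x)         ≈⟨ ∏F.∑-cong k*l ⟨
    ∏F.∑ (λ y → k y * l y) ≈⟨ ∏F.∑-∙ k l ⟩
    ∏F.∑ k * ∏F.∑ l        ≈⟨ *-cong ∏k≈1 ∏l≈x ⟩
    1# * x                 ≈⟨ *-identityˡ x ⟩
    x                      ∎
    where
    -- The products run over the whole field, so h replaces zero by 1. The constant x is split as
    -- `k * l`, where k carries x at the nonzero elements and l carries it at zero: this is x^q =
    -- x^(q-1) x.
    h k l : Carrier → Carrier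
    h y = if does (y ≟ 0#) then 1# else y
    k y = if does (y ≟ 0#) then 1# else x
    l y = if does (y ≟ 0#) then x else 1#

    h≉0 : ∀ y → ¬ h y ≈ 0#
    h≉0 y with y ≟ 0#
    ... | yes _  = 1≉0
    ... | no y≉0 = y≉0

    k*l : ∀ y → k y * l y ≈ x
    k*l y with y ≟ 0#
    ... | yes _ = *-identityˡ x
    ... | no _  = *-identityʳ x

    h-cong : ∀ {y z} → y ≈ z → h y ≈ h z
    h-cong {y} {z} y≈z with y ≟ 0# | z ≟ 0#
    ... | yes _   | yes _   = refl
    ... | yes y≈0 | no z≉0  = contradiction (trans (sym y≈z) y≈0) z≉0
    ... | no y≉0  | yes z≈0 = contradiction (trans y≈z z≈0) y≉0
    ... | no _    | no _    = y≈z

    k*h : ∀ y → h (x * y) ≈ k y * h y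
    k*h y with y ≟ 0# | (x * y) ≟ 0#
    ... | yes _   | yes _    = sym (*-identityˡ 1#)
    ... | yes y≈0 | no xy≉0  = contradiction (trans (*-congˡ y≈0) (zeroʳ x)) xy≉0
    ... | no y≉0  | yes xy≈0 = contradiction xy≈0 (*-≉0 x≉0 y≉0)
    ... | no _    | no _     = refl

    product≉0 : ∀ {n} (t : Fin n → Carrier) → (∀ i → ¬ t i ≈ 0#) → ¬ ∏.sum t ≈ 0#
    product≉0 {zero}  t t≉0 = 1≉0
    product≉0 {suc n} t t≉0 = *-≉0 (t≉0 zero) (product≉0 (t ∘ suc) (t≉0 ∘ suc))

    ∏h≉0 : ¬ ∏F.∑ h ≈ 0#
    ∏h≉0 ∏h≈0 = product≉0 (h ∘ Inverse.from enumeration) (λ i → h≉0 _)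
      (trans (reflexive (≡.sym (∏F.∑-sum h))) ∏h≈0)

    ∏k≈1 : ∏F.∑ k ≈ 1#
    ∏k≈1 = *-cancelˡ-≉0 ∏h≉0 (begin
      ∏F.∑ h * ∏F.∑ k        ≈⟨ *-comm _ _ ⟩
      ∏F.∑ k * ∏F.∑ h        ≈⟨ ∏F.∑-∙ k h ⟨
      ∏F.∑ (λ y → k y * h y) ≈⟨ ∏F.∑-cong k*h ⟨
      ∏F.∑ (h ∘ (x *_))      ≈⟨ ∏F.∑-bijection h h-cong (scaling x≉0) ⟩
      ∏F.∑ h                 ≈⟨ *-identityʳ _ ⟨
      ∏F.∑ h * 1#            ∎)

    l-0 : ∀ {y} → y ≈ 0# → l y ≈ x
    l-0 {y} y≈0 with y ≟ 0#
    ... | yes _  = refl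
    ... | no y≉0 = contradiction y≈0 y≉0

    ∏l≈x : ∏F.∑ l ≈ x
    ∏l≈x = trans (∏F.∑-single l 0# (λ y≈0 → trans (l-0 y≈0) (sym (l-0 refl))) l-≉0) (l-0 refl)
      where
      l-≉0 : ∀ y → ¬ y ≈ 0# → l y ≈ 1#
      l-≉0 y y≉0 with y ≟ 0#
      ... | yes y≈0 = contradiction y≈0 y≉0
      ... | no _    = refl

  -- A nonzero remainder of n modulo p is coprime to p, and both vanish in the field, so a Bézout
  -- relation would give 1 = 0.
  fromℕ-n≈0⇒p∣n : ∀ n → fromℕ n ≈ 0# → p ∣ n
  fromℕ-n≈0⇒p∣n n n≈0 with n % p in n%p
  ... | zero  = m%n≡0⇒n∣m n p n%p
  ... | suc r = contradiction (bézout (coprime-Bézout (prime⇒coprime p-prime 1+r<p))) 1≉0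
    where
    1+r<p : suc r < p
    1+r<p = ≡.subst (_< p) n%p (m%n<n n p)
    fromℕ-r≈0 : fromℕ (suc r) ≈ 0#
    fromℕ-r≈0 = begin
      fromℕ (suc r)                           ≈⟨ +-identityʳ _ ⟨
      fromℕ (suc r) + 0#                      ≈⟨ +-congˡ (fromℕ-∣ (n∣m*n (n / p)) fromℕ-p≈0) ⟨
      fromℕ (suc r) + fromℕ (n / p ℕ.* p)     ≈⟨ ×-homo-+ 1# (suc r) (n / p ℕ.* p) ⟨
      fromℕ (suc r ℕ.+ n / p ℕ.* p)           ≡⟨ ≡.cong fromℕ (≡.trans (m≡m%n+[m/n]*n n p)
                                                    (≡.cong (ℕ._+ n / p ℕ.* p) n%p)) ⟨
      fromℕ n                                 ≈⟨ n≈0 ⟩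
      0#                                      ∎
    one : ∀ {i j} → fromℕ i ≈ 0# → fromℕ j ≈ 0# → 1 ℕ.+ i ≡ j → 1# ≈ 0#
    one i≈0 j≈0 eq = trans (sym (trans (+-congˡ i≈0) (+-identityʳ 1#)))
                           (trans (×-congˡ eq) j≈0)
    bézout : Bézout.Identity 1 p (suc r) → 1# ≈ 0#
    bézout (Bézout.+- x y eq) = one (fromℕ-∣ (n∣m*n y) fromℕ-r≈0) (fromℕ-∣ (n∣m*n x) fromℕ-p≈0) eq
    bézout (Bézout.-+ x y eq) = one (fromℕ-∣ (n∣m*n x) fromℕ-p≈0) (fromℕ-∣ (n∣m*n y) fromℕ-r≈0) eq

  fromℕ-≈⇒p∣∸ : ∀ {i j} → i ≤ j → fromℕ i ≈ fromℕ j → p ∣ j ∸ i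
  fromℕ-≈⇒p∣∸ {i} {j} i≤j eq = fromℕ-n≈0⇒p∣n (j ∸ i) (+-cancelˡ (fromℕ i) _ _ (begin
    fromℕ i + fromℕ (j ∸ i)  ≈⟨ ×-homo-+ 1# i (j ∸ i) ⟨
    fromℕ (i ℕ.+ (j ∸ i))    ≡⟨ ≡.cong fromℕ (ℕ.m+[n∸m]≡n i≤j) ⟩
    fromℕ j                  ≈⟨ eq ⟨
    fromℕ i                  ≈⟨ +-identityʳ _ ⟨
    fromℕ i + 0#             ∎))

  fromℕ-injective-≤ : ∀ {i j} → i ≤ j → j < p → fromℕ i ≈ fromℕ j → i ≡ j
  fromℕ-injective-≤ {i} {j} i≤j j<p eq with j ∸ i in j∸i | fromℕ-≈⇒p∣∸ i≤j eq
  ... | zero  | _    = ℕ.≤-antisym i≤j (ℕ.m∸n≡0⇒m≤n j∸i)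
  ... | suc d | p∣d = contradiction (∣⇒≤ p∣d)
    (ℕ.<⇒≱ (ℕ.≤-<-trans (ℕ.≤-trans (ℕ.≤-reflexive (≡.sym j∸i)) (ℕ.m∸n≤m j i)) j<p))

  fromℕ-toℕ-injective : ∀ {i j : Fin p} → fromℕ (toℕ i) ≈ fromℕ (toℕ j) → i ≡ j
  fromℕ-toℕ-injective {i} {j} eq = toℕ-injective ([ (λ i≤j → fromℕ-injective-≤ i≤j (toℕ<n j) eq)
    , (λ j≤i → ≡.sym (fromℕ-injective-≤ j≤i (toℕ<n i) (sym eq))) ]′ (ℕ.≤-total (toℕ i) (toℕ j)))

  -- The inner binomial coefficients are multiples of n and vanish. The exponent is a variable so
  -- that it can be matched as a successor, which exposes both end terms of the sum.
  binomial-prime : ∀ n → Prime n → fromℕ n ≈ 0# → ∀ x y → (x + y) ^ n ≈ x ^ n + y ^ n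
  binomial-prime zero    n-prime _   x y = contradiction n-prime ¬prime[0]
  binomial-prime (suc n) n-prime n≈0 x y = begin
    (x + y) ^ suc n
      ≈⟨ theorem (suc n) x y ⟩
    sum t
      ≈⟨ +-congˡ (sum-init-last (t ∘ suc)) ⟩
    t zero + (sum (λ i → t (suc (inject₁ i))) + t (suc (Fin.fromℕ n)))
      ≈⟨ +-cong first (+-cong (sum-ε {n} middle) last) ⟩
    y ^ suc n + (0# + x ^ suc n)
      ≈⟨ +-congˡ (+-identityˡ _) ⟩
    y ^ suc n + x ^ suc n
      ≈⟨ +-comm _ _ ⟩
    x ^ suc n + y ^ suc n ∎
    where
    open Binomial (CommutativeRing.commutativeSemiring commutativeRing) using (theorem; binomialTerm)
    t : Fin (suc (suc n)) → Carrier
    t = binomialTerm x y (suc n)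
    first : t zero ≈ y ^ suc n
    first = trans (+-identityʳ _) (*-identityˡ _)
    middle : ∀ i → t (suc (inject₁ i)) ≈ 0#
    middle i = trans (×-congʳ c′ (sym (*-identityˡ _))) (trans (sym (×-assoc-* c′ 1# _))
      (trans (*-congʳ (fromℕ-∣ (prime∣C n-prime (s≤s z≤n)
        (s≤s (≡.subst (_< n) (≡.sym (toℕ-inject₁ i)) (toℕ<n i)))) n≈0)) (zeroˡ _)))
      where
      c′ = (suc n) C (suc (toℕ (inject₁ i)))
    last : t (suc (Fin.fromℕ n)) ≈ x ^ suc n
    last rewrite toℕ-fromℕ n | nCn≡1 (suc n) | ℕ.n∸n≡0 n =
      trans (+-identityʳ _) (*-identityʳ _)

  frobenius-+ : ∀ x y → (x + y) ^ p ≈ x ^ p + y ^ p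
  frobenius-+ = binomial-prime p p-prime fromℕ-p≈0

  0^p≈0 : 0# ^ p ≈ 0#
  0^p≈0 with suc n ← p | _ ← 1<p = zeroˡ _

  1^n≈1 : ∀ n → 1# ^ n ≈ 1#
  1^n≈1 zero    = refl
  1^n≈1 (suc n) = trans (*-identityˡ _) (1^n≈1 n)

  -- By Fermat, here an induction through Frobenius, 0, ..., p - 1 are already p roots of X^p - X;
  -- any further root exceeds the degree.
  x^p≈x⇒x∈ℕ : ∀ {x} → x ^ p ≈ x → ∃[ t ] fromℕ (toℕ {p} t) ≈ x
  x^p≈x⇒x∈ℕ {x} x^p≈x = decidable-stable (any? λ t → fromℕ (toℕ t) ≟ x) λ x∉ℕ →
    absurd x∉ℕ p 1<p ≡.refl
    where
    -- The coefficient list of X^p - X can only be written down once p has the shape 2 + n.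
    absurd : ¬ (∃[ t ] fromℕ (toℕ {p} t) ≈ x) → ∀ n → 1 < n → n ≡ p → ⊥
    absurd x∉ℕ (suc (suc n)) _ 2+n≡p = too-many-roots p X^p-X length≡p ρ ρ-injective root
      where
      X^p-X = 0# ∷ - 1# ∷ replicate n 0#
      length≡p : length X^p-X ≡ p
      length≡p = ≡.trans (≡.cong (2 ℕ.+_) (length-replicate n)) 2+n≡p
      fixed⇒root : ∀ {y} → y ^ p ≈ y → monic X^p-X y ≈ 0#
      fixed⇒root {y} y^p≈y = begin
        0# + y * (- 1# + y * monic (replicate n 0#) y)
          ≈⟨ +-identityˡ _ ⟩
        y * (- 1# + y * monic (replicate n 0#) y)
          ≈⟨ *-congˡ (+-congˡ (*-congˡ (monic-power n y))) ⟩
        y * (- 1# + y ^ suc n)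
          ≈⟨ distribˡ _ _ _ ⟩
        y * - 1# + y ^ suc (suc n)
          ≈⟨ +-cong (trans (sym (-‿distribʳ-* y 1#)) (-‿cong (*-identityʳ y)))
                    (trans (^-congʳ y 2+n≡p) y^p≈y) ⟩
        - y + y
          ≈⟨ -‿inverseˡ y ⟩
        0# ∎
      ρ : Fin (suc p) → Carrier
      ρ zero    = x
      ρ (suc t) = fromℕ (toℕ t)
      ρ-injective : ∀ {i j} → ρ i ≈ ρ j → i ≡ j
      ρ-injective {zero}  {zero}  eq = ≡.refl
      ρ-injective {zero}  {suc j} eq = contradiction (j , sym eq) x∉ℕ
      ρ-injective {suc i} {zero}  eq = contradiction (i , eq) x∉ℕ
      ρ-injective {suc i} {suc j} eq = ≡.cong suc (fromℕ-toℕ-injective eq)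
      root : ∀ i → monic X^p-X (ρ i) ≈ 0#
      root zero    = fixed⇒root x^p≈x
      root (suc t) = fixed⇒root (fermat (toℕ t))
        where
        fermat : ∀ k → fromℕ k ^ p ≈ fromℕ k
        fermat zero    = 0^p≈0
        fermat (suc k) = trans (frobenius-+ 1# (fromℕ k)) (+-cong (1^n≈1 p) (fermat k))
    absurd _ (suc zero) (s≤s ()) _

  -- The trace

  partialTrace : ℕ → Carrier → Carrier
  partialTrace k x = sum {k} (λ j → x ^ (p ℕ.^ toℕ j))

  partialTrace-suc : ∀ k x → partialTrace (suc k) x ≈ partialTrace k x + x ^ (p ℕ.^ k)
  partialTrace-suc k x = trans (sum-init-last {k} (λ j → x ^ (p ℕ.^ toℕ j))) (+-cong
    (sum-cong {k} λ j → ^-congʳ x (≡.cong (p ℕ.^_) (toℕ-inject₁ j)))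
    (^-congʳ x (≡.cong (p ℕ.^_) (toℕ-fromℕ k))))

  ^p^suc : ∀ k x → (x ^ (p ℕ.^ k)) ^ p ≈ x ^ (p ℕ.^ suc k)
  ^p^suc k x = trans (^-assocʳ x (p ℕ.^ k) p) (^-congʳ x (ℕ.*-comm (p ℕ.^ k) p))

  -- Frobenius raises every exponent p^j to p^(j+1), so only the two end terms differ. At k = `m`
  -- they agree by `x^q≈x`, and the trace is fixed by Frobenius.
  partialTrace^p : ∀ k x → partialTrace k x ^ p + x ≈ partialTrace k x + x ^ (p ℕ.^ k)
  partialTrace^p zero    x = +-cong 0^p≈0 (sym (*-identityʳ x))
  partialTrace^p (suc k) x = begin
    partialTrace (suc k) x ^ p + x
      ≈⟨ +-congʳ (trans (^-congˡ p (partialTrace-suc k x)) (frobenius-+ _ _)) ⟩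
    partialTrace k x ^ p + (x ^ (p ℕ.^ k)) ^ p + x
      ≈⟨ xy∙z≈xz∙y _ _ _ ⟩
    partialTrace k x ^ p + x + (x ^ (p ℕ.^ k)) ^ p
      ≈⟨ +-cong (partialTrace^p k x) (^p^suc k x) ⟩
    partialTrace k x + x ^ (p ℕ.^ k) + x ^ (p ℕ.^ suc k)
      ≈⟨ +-congʳ (partialTrace-suc k x) ⟨
    partialTrace (suc k) x + x ^ (p ℕ.^ suc k) ∎
    where open import Algebra.Properties.CommutativeSemigroup +-commutativeSemigroup

  Tr^p≈Tr : ∀ x → Tr x ^ p ≈ Tr x
  Tr^p≈Tr x = +-cancelʳ x _ _ (trans (partialTrace^p m x) (+-congˡ (x^q≈x x)))

  ^p^k-+ : ∀ k x y → (x + y) ^ (p ℕ.^ k) ≈ x ^ (p ℕ.^ k) + y ^ (p ℕ.^ k)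
  ^p^k-+ zero    x y = trans (*-identityʳ _) (sym (+-cong (*-identityʳ x) (*-identityʳ y)))
  ^p^k-+ (suc k) x y = begin
    (x + y) ^ (p ℕ.^ suc k)                    ≈⟨ ^p^suc k (x + y) ⟨
    ((x + y) ^ (p ℕ.^ k)) ^ p                  ≈⟨ ^-congˡ p (^p^k-+ k x y) ⟩
    (x ^ (p ℕ.^ k) + y ^ (p ℕ.^ k)) ^ p        ≈⟨ frobenius-+ _ _ ⟩
    (x ^ (p ℕ.^ k)) ^ p + (y ^ (p ℕ.^ k)) ^ p  ≈⟨ +-cong (^p^suc k x) (^p^suc k y) ⟩
    x ^ (p ℕ.^ suc k) + y ^ (p ℕ.^ suc k)      ∎

  Tr-+ : ∀ x y → Tr (x + y) ≈ Tr x + Tr y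
  Tr-+ x y = trans (sum-cong {m} (λ j → ^p^k-+ (toℕ j) x y)) (∑-distrib-+ {m} _ _)

  Tr-cong : ∀ {x y} → x ≈ y → Tr x ≈ Tr y
  Tr-cong x≈y = sum-cong {m} (λ j → ^-congˡ (p ℕ.^ toℕ j) x≈y)

  -- Fixed points of Frobenius lie in the prime subfield, so the default value of `residue` is not
  -- reached.
  fromℕ-residue : ∀ y → y ^ p ≈ y → fromℕ (residue y) ≈ y
  fromℕ-residue y y^p≈y with any? {p} (λ t → fromℕ (toℕ t) ≟ y)
  ... | yes (_ , eq) = eq
  ... | no y∉ℕ       = contradiction (x^p≈x⇒x∈ℕ y^p≈y) y∉ℕ

  fromℕ-residue-Tr : ∀ x → fromℕ (residue (Tr x)) ≈ Tr x
  fromℕ-residue-Tr x = fromℕ-residue (Tr x) (Tr^p≈Tr x)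

  -- The polynomial X + X^p + ... + X^(p^k), with the last power as implicit leading term. It has k
  -- + 1 terms, hence the shift against `partialTrace`.
  traceCoefficients : ℕ → List Carrier
  traceCoefficients zero    = 0# ∷ []
  traceCoefficients (suc k) = addPower (traceCoefficients k) (p ℕ.^ suc k)

  length-traceCoefficients : ∀ k → length (traceCoefficients k) ≡ p ℕ.^ k
  length-traceCoefficients zero    = ≡.refl
  length-traceCoefficients (suc k) = length-addPower (traceCoefficients k) _

  monic-traceCoefficients : ∀ k x → monic (traceCoefficients k) x ≈ partialTrace (suc k) x
  monic-traceCoefficients zero    x = +-comm _ _
  monic-traceCoefficients (suc k) x = begin
    monic (traceCoefficients (suc k)) x
      ≈⟨ monic-addPower (traceCoefficients k)
           (≡.subst (_< p ℕ.^ suc k) (≡.sym (length-traceCoefficients k)) (ℕ.^-monoʳ-< p 1<p (ℕ.n<1+n k))) x ⟩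
    monic (traceCoefficients k) x + x ^ (p ℕ.^ suc k)
      ≈⟨ +-congʳ (monic-traceCoefficients k x) ⟩
    partialTrace (suc k) x + x ^ (p ℕ.^ suc k)
      ≈⟨ partialTrace-suc (suc k) x ⟨
    partialTrace (suc (suc k)) x ∎

  from-injective : ∀ {i j} → Inverse.from enumeration i ≈ Inverse.from enumeration j → i ≡ j
  from-injective eq = ≡.trans (≡.sym (Inverse.inverseˡ enumeration refl))
                        (≡.trans (Inverse.to-cong enumeration eq) (Inverse.inverseˡ enumeration refl))

  m≢0 : ¬ m ≡ 0
  m≢0 m≡0 = 1≉0 (trans (sym (+-identityʳ 1#))
    (trans (×-congˡ (≡.sym (≡.cong (p ℕ.^_) m≡0))) fromℕ-q≈0))

  -- The trace is a monic polynomial of degree p^(m-1), which is less than q, and cannot vanish on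
  -- all q elements.
  Tr-nontrivial : ∃[ x ] ¬ Tr x ≈ 0#
  Tr-nontrivial with any? {q} (λ i → ¬? (Tr (Inverse.from enumeration i) ≟ 0#))
  ... | yes (i , Tr≉0) = Inverse.from enumeration i , Tr≉0
  ... | no ¬Tr≉0       = contradiction ≡.refl (absurd m)
    where
    absurd : ∀ k → ¬ k ≡ m
    absurd zero    0≡m   = m≢0 (≡.sym 0≡m)
    absurd (suc k) 1+k≡m = too-many-roots (p ℕ.^ k) (traceCoefficients k) (length-traceCoefficients k)
      (Inverse.from enumeration ∘ embed) (Finₚ.inject≤-injective p^k<q p^k<q _ _ ∘ from-injective)
      (λ i → root (embed i))
      where
      p^k<q : p ℕ.^ k < q
      p^k<q = ℕ.^-monoʳ-< p 1<p (ℕ.≤-reflexive 1+k≡m)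
      -- The root bound takes exactly one root more than the degree, so only p^k + 1 of the q
      -- elements are used.
      embed : Fin (suc (p ℕ.^ k)) → Fin q
      embed i = inject≤ i p^k<q
      root : ∀ i → monic (traceCoefficients k) (Inverse.from enumeration i) ≈ 0#
      root i = trans (monic-traceCoefficients k _)
        (trans (reflexive (≡.cong (λ l → partialTrace l _) 1+k≡m))
          (decidable-stable (_ ≟ 0#) λ Tr≉0 → ¬Tr≉0 (i , Tr≉0)))

-- The canonical character

-- This interface separates the Fourier analysis from `exp` and the trace.
record AdditiveCharacter {a ℓ₁ c ℓ₂} (F : Field a ℓ₁) (K : Field c ℓ₂) : Set (a ⊔ ℓ₁ ⊔ c ⊔ ℓ₂) where
  private
    module F = Field F
    module K = Field K
  field
    χ          : F.Carrier → K.Carrier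
    χ-cong     : ∀ {x y} → x F.≈ y → χ x K.≈ χ y
    χ-0        : χ F.0# K.≈ K.1#
    χ-+        : ∀ x y → χ (x F.+ y) K.≈ χ x K.* χ y
    nontrivial : ∃[ x ] ¬ χ x K.≈ K.1#

module _ {a ℓ₁ c ℓ₂} (𝔽 : FiniteField a ℓ₁) (ℂ : ComplexExponential c ℓ₂) where
  private
    module F where
      open FiniteField 𝔽 using (p; p-prime; Tr; residue) public
      open FieldProperties (FiniteField.baseField 𝔽) public
      open FiniteFieldProperties 𝔽 public
    instance
      p≢0 : ℕ.NonZero F.p
      p≢0 = prime⇒nonZero F.p-prime
  open F using (p; Tr; residue)
  open ComplexExponential ℂ
    using (baseField; characteristicZero; exp; exp-cong; exp-0; exp-+; 2πi; 2πi≉0; exp-2πi; exp-ker)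
  open FieldProperties baseField
  open CharacteristicZero characteristicZero
  open import Relation.Binary.Reasoning.Setoid setoid

  fromℕ-p≉0 : ¬ fromℕ p ≈ 0#
  fromℕ-p≉0 p≈0 = ℕ.≢-nonZero⁻¹ p (fromℕ-injective p 0 p≈0)

  -- The canonical character is this function at `residue (Tr x)`. On ℕ it is exactly additive,
  -- whereas `residue` is additive only modulo p.
  rootOfUnity : ℕ → Carrier
  rootOfUnity n = exp (2πi * fromℕ n * fromℕ p ⁻¹)

  rootOfUnity-+ : ∀ i j → rootOfUnity (i ℕ.+ j) ≈ rootOfUnity i * rootOfUnity j
  rootOfUnity-+ i j = trans
    (exp-cong (trans (*-congʳ (trans (*-congˡ (×-homo-+ 1# i j)) (distribˡ _ _ _))) (distribʳ _ _ _)))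
    (exp-+ _ _)

  rootOfUnity-0 : rootOfUnity 0 ≈ 1#
  rootOfUnity-0 = trans (exp-cong (trans (*-congʳ (zeroʳ _)) (zeroˡ _))) exp-0

  rootOfUnity-p : rootOfUnity p ≈ 1#
  rootOfUnity-p = trans (exp-cong (trans (*-assoc _ _ _)
    (trans (*-congˡ (⁻¹-inverse fromℕ-p≉0)) (*-identityʳ _)))) exp-2πi

  rootOfUnity-∣ : ∀ {n} → p ∣ n → rootOfUnity n ≈ 1#
  rootOfUnity-∣ (divides k ≡.refl) = multiples k
    where
    multiples : ∀ k → rootOfUnity (k ℕ.* p) ≈ 1#
    multiples zero    = rootOfUnity-0
    multiples (suc k) = trans (rootOfUnity-+ p (k ℕ.* p))
      (trans (*-cong rootOfUnity-p (multiples k)) (*-identityˡ 1#))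

  rootOfUnity-≤ : ∀ {i j} → i ≤ j → F.fromℕ i F.≈ F.fromℕ j → rootOfUnity i ≈ rootOfUnity j
  rootOfUnity-≤ {i} {j} i≤j eq = begin
    rootOfUnity i                      ≈⟨ *-identityʳ _ ⟨
    rootOfUnity i * 1#                 ≈⟨ *-congˡ (rootOfUnity-∣ (F.fromℕ-≈⇒p∣∸ i≤j eq)) ⟨
    rootOfUnity i * rootOfUnity (j ∸ i)  ≈⟨ rootOfUnity-+ i (j ∸ i) ⟨
    rootOfUnity (i ℕ.+ (j ∸ i))        ≡⟨ ≡.cong rootOfUnity (ℕ.m+[n∸m]≡n i≤j) ⟩
    rootOfUnity j                      ∎

  -- Equality of the images in the finite field is congruence modulo p, so properties of the trace
  -- transfer to χ without computing any residue.
  rootOfUnity-cong : ∀ i j → F.fromℕ i F.≈ F.fromℕ j → rootOfUnity i ≈ rootOfUnity j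
  rootOfUnity-cong i j eq = [ (λ i≤j → rootOfUnity-≤ i≤j eq)
                            , (λ j≤i → sym (rootOfUnity-≤ j≤i (F.sym eq))) ]′ (ℕ.≤-total i j)

  -- The kernel of `exp` gives 2πi n / p = (a - b) 2πi. Cancelling 2πi and clearing p yields bp + n
  -- = ap, first in the field and then in ℕ.
  rootOfUnity≈1⇒p∣n : ∀ n → rootOfUnity n ≈ 1# → p ∣ n
  rootOfUnity≈1⇒p∣n n eq with exp-ker _ eq
  ... | a , b , z≈ = ∣m+n∣m⇒∣n (≡.subst (p ∣_) (≡.sym bp+n≡ap) (n∣m*n a)) (n∣m*n b)
    where
    ·≈* : ∀ k → k · 2πi ≈ 2πi * fromℕ k
    ·≈* k = trans (×-congʳ k (sym (*-identityˡ _))) (trans (sym (×-assoc-* k 1# 2πi)) (*-comm _ _))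

    scaled : 2πi * (fromℕ b + fromℕ n * fromℕ p ⁻¹) ≈ 2πi * fromℕ a
    scaled = begin
      2πi * (fromℕ b + fromℕ n * fromℕ p ⁻¹)
        ≈⟨ distribˡ _ _ _ ⟩
      2πi * fromℕ b + 2πi * (fromℕ n * fromℕ p ⁻¹)
        ≈⟨ +-cong (sym (·≈* b)) (trans (sym (*-assoc _ _ _)) z≈) ⟩
      b · 2πi + (a · 2πi - b · 2πi)
        ≈⟨ x∙yz≈y∙xz _ _ _ ⟩
      a · 2πi + (b · 2πi - b · 2πi)
        ≈⟨ +-congˡ (-‿inverseʳ _) ⟩
      a · 2πi + 0#
        ≈⟨ trans (+-identityʳ _) (·≈* a) ⟩
      2πi * fromℕ a ∎
      where open import Algebra.Properties.CommutativeSemigroup +-commutativeSemigroup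

    bp+n≡ap : b ℕ.* p ℕ.+ n ≡ a ℕ.* p
    bp+n≡ap = fromℕ-injective _ _ (begin
      fromℕ (b ℕ.* p ℕ.+ n)
        ≈⟨ trans (×-homo-+ 1# (b ℕ.* p) n) (+-congʳ (×1-homo-* b p)) ⟩
      fromℕ b * fromℕ p + fromℕ n
        ≈⟨ +-congˡ (trans (sym (*-identityʳ _)) (*-congˡ (trans (sym (⁻¹-inverse fromℕ-p≉0)) (*-comm _ _)))) ⟩
      fromℕ b * fromℕ p + fromℕ n * (fromℕ p ⁻¹ * fromℕ p)
        ≈⟨ +-congˡ (*-assoc _ _ _) ⟨
      fromℕ b * fromℕ p + fromℕ n * fromℕ p ⁻¹ * fromℕ p
        ≈⟨ distribʳ _ _ _ ⟨
      (fromℕ b + fromℕ n * fromℕ p ⁻¹) * fromℕ p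
        ≈⟨ *-congʳ (*-cancelˡ-≉0 2πi≉0 scaled) ⟩
      fromℕ a * fromℕ p
        ≈⟨ ×1-homo-* a p ⟨
      fromℕ (a ℕ.* p) ∎)

  canonicalAdditiveCharacter : AdditiveCharacter (FiniteField.baseField 𝔽) baseField
  canonicalAdditiveCharacter = record
    { χ          = canonicalCharacter 𝔽 ℂ
    ; χ-cong     = λ {x} {y} x≈y → rootOfUnity-cong (residue (Tr x)) (residue (Tr y))
        (F.trans (F.fromℕ-residue-Tr x) (F.trans (F.Tr-cong x≈y) (F.sym (F.fromℕ-residue-Tr y))))
    ; χ-0        = trans (rootOfUnity-cong (residue (Tr F.0#)) 0
        (F.trans (F.fromℕ-residue-Tr F.0#) Tr-0)) rootOfUnity-0
    ; χ-+        = λ x y → trans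
        (rootOfUnity-cong (residue (Tr (x F.+ y))) (residue (Tr x) ℕ.+ residue (Tr y))
          (F.trans (F.fromℕ-residue-Tr (x F.+ y)) (F.trans (F.Tr-+ x y)
            (F.trans (F.sym (F.+-cong (F.fromℕ-residue-Tr x) (F.fromℕ-residue-Tr y)))
              (F.sym (F.×-homo-+ F.1# (residue (Tr x)) _))))))
        (rootOfUnity-+ (residue (Tr x)) _)
    -- If χ x were 1, p would divide the residue of the trace, and the trace would vanish.
    ; nontrivial = x , λ χx≈1 → Trx≉0 (F.trans (F.sym (F.fromℕ-residue-Tr x))
        (F.fromℕ-∣ (rootOfUnity≈1⇒p∣n (residue (Tr x)) χx≈1) F.fromℕ-p≈0))
    }
    where
    x = proj₁ F.Tr-nontrivial
    Trx≉0 = proj₂ F.Tr-nontrivial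
    Tr-0 : Tr F.0# F.≈ F.0#
    Tr-0 = F.x+x≈x⇒x≈0 _ (F.trans (F.sym (F.Tr-+ F.0# F.0#)) (F.Tr-cong (F.+-identityˡ F.0#)))

-- Fourier analysis on Mat₂

module FieldSums {c ℓ} (K : Field c ℓ) {s r} (S : Setoid s r) {n} (e : Inverse S (≡.setoid (Fin n))) where
  open FieldProperties K
  open Over S e public
  private module S = Setoid S

  opaque
    unfolding ∑

    ∑-*ˡ : ∀ x f → x * ∑ f ≈ ∑ (λ y → x * f y)
    ∑-*ˡ x f = *-distribˡ-sum {n} x _

    ∑-*ʳ : ∀ x f → ∑ f * x ≈ ∑ (λ y → f y * x)
    ∑-*ʳ x f = *-distribʳ-sum {n} x _

  ∑-𝟙 : ∀ (f : S.Carrier → Carrier) x₀ (P? : ∀ x → Dec (x S.≈ x₀)) → (∀ {x} → x S.≈ x₀ → f x ≈ f x₀) →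
        ∑ (λ x → 𝟙 (P? x) * f x) ≈ f x₀
  ∑-𝟙 f x₀ P? f-cong = trans
    (∑-single _ x₀
      (λ {x} x≈x₀ → *-cong (𝟙-⇔ (P? x) (P? x₀) (λ _ → S.refl) (λ _ → x≈x₀)) (f-cong x≈x₀))
      (λ x x≉x₀ → trans (*-congʳ (𝟙-no (P? x) x≉x₀)) (zeroˡ _)))
    (trans (*-congʳ (𝟙-yes (P? x₀) S.refl)) (*-identityˡ _))

  ∑-split : ∀ (f : S.Carrier → Carrier) x₀ (P? : ∀ x → Dec (x S.≈ x₀)) → (∀ {x} → x S.≈ x₀ → f x ≈ f x₀) →
            ∑ f ≈ f x₀ + ∑ (λ x → 𝟙 (¬? (P? x)) * f x)
  ∑-split f x₀ P? f-cong = trans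
    (trans (∑-cong λ x → complement (P? x)) (∑-∙ _ _))
    (+-congʳ (∑-𝟙 f x₀ P? f-cong))
    where
    complement : ∀ {p} {P : Set p} (P? : Dec P) {y} → y ≈ 𝟙 P? * y + 𝟙 (¬? P?) * y
    complement (yes _) = sym (trans (+-cong (*-identityˡ _) (zeroˡ _)) (+-identityʳ _))
    complement (no _)  = sym (trans (+-cong (zeroˡ _) (*-identityˡ _)) (+-identityˡ _))

module Fourier {a ℓ₁ c ℓ₂} (𝔽 : FiniteField a ℓ₁) (K : Field c ℓ₂)
  (char0 : ∀ n → ¬ Field._≈_ K (Field.fromℕ K (suc n)) (Field.0# K))
  (character : AdditiveCharacter (FiniteField.baseField 𝔽) K) where

  module F where
    open FiniteField 𝔽 using (q; enumeration; nonzeroElements; elements) public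
    open FieldProperties (FiniteField.baseField 𝔽) public
    open FiniteFieldProperties 𝔽 public
  open F using (q; nonzeroElements)
  open FieldProperties K
  open CharacteristicZero char0
  open AdditiveCharacter character
  open import Relation.Binary.Reasoning.Setoid setoid
  open SemiringSolver (CommutativeRing.commutativeSemiring commutativeRing)
  module ∑F = FieldSums K F.setoid F.enumeration
  open ∑F using () renaming (∑ to ∑F)

  Q : Carrier
  Q = fromℕ q

  Q≉0 : ¬ Q ≈ 0#
  Q≉0 Q≈0 with suc n ← q | _ ← F.q>0 = char0 n Q≈0

  -- Translation by z multiplies the sum by χ z, which differs from 1.
  ∑χ≈0 : ∑F χ ≈ 0#
  ∑χ≈0 with nontrivial
  ... | z , χz≉1 = x*y≈0⇒y≈0 (λ eq → χz≉1 (x-y≈0⇒x≈y _ _ eq)) (begin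
    (χ z - 1#) * ∑F χ          ≈⟨ [y-z]x≈yx-zx _ _ _ ⟩
    χ z * ∑F χ - 1# * ∑F χ     ≈⟨ +-cong shifted (-‿cong (*-identityˡ _)) ⟩
    ∑F χ - ∑F χ                ≈⟨ -‿inverseʳ _ ⟩
    0#                         ∎)
    where
    shifted : χ z * ∑F χ ≈ ∑F χ
    shifted = begin
      χ z * ∑F χ                ≈⟨ ∑F.∑-*ˡ (χ z) χ ⟩
      ∑F (λ x → χ z * χ x)      ≈⟨ ∑F.∑-cong (λ x → trans (χ-+ x z) (*-comm _ _)) ⟨
      ∑F (λ x → χ (x F.+ z))    ≈⟨ ∑F.∑-bijection χ χ-cong (translation F.+-group z) ⟩
      ∑F χ                      ∎

  ∑χ : ∀ w → ∑F (λ x → χ (w F.* x)) ≈ Q * 𝟙 (w F.≟ F.0#)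
  ∑χ w with w F.≟ F.0#
  ... | yes w≈0 = trans
    (trans (∑F.∑-cong λ x → trans (χ-cong (F.trans (F.*-congʳ w≈0) (F.zeroˡ x))) χ-0) (∑F.∑-const 1#))
    (sym (*-identityʳ Q))
  ... | no w≉0 = trans (∑F.∑-bijection χ χ-cong (F.scaling w≉0)) (trans ∑χ≈0 (sym (zeroʳ Q)))

  sumOver-nonzero : ∀ f → sumOver nonzeroElements f ≈ ∑F (λ x → 𝟙 (¬? (x F.≟ F.0#)) * f x)
  sumOver-nonzero f = trans (sumOver-filter (λ x → ¬? (x F.≟ F.0#)) F.elements f)
    (trans (sumOver-map (Inverse.from F.enumeration) (allFin q) (λ x → 𝟙 (¬? (x F.≟ F.0#)) * f x))
           (trans (sumOver-tabulate {n = q} id _) (reflexive (≡.sym (∑F.∑-sum _)))))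

  sumOver-nonzero-cong : ∀ {f g} → (∀ {x} → ¬ x F.≈ F.0# → f x ≈ g x) →
                         sumOver nonzeroElements f ≈ sumOver nonzeroElements g
  sumOver-nonzero-cong = sumOver-All (all-filter (λ x → ¬? (x F.≟ F.0#)) F.elements)

  ∑-zero+nonzero : ∀ f → (∀ {x} → x F.≈ F.0# → f x ≈ f F.0#) →
                   ∑F f ≈ f F.0# + sumOver nonzeroElements f
  ∑-zero+nonzero f f-cong = trans (∑F.∑-split f F.0# (λ x → x F.≟ F.0#) f-cong)
    (+-congˡ (sym (sumOver-nonzero f)))

  -- The double sum of χ(sx + txy + vy). The form - t det Z is bilinear in (a, d) with coefficient
  -- -t plus bilinear in (b, c) with coefficient t. Collecting x lets the inner sum detect s + ty =
  -- 0.
  bilinearSum : F.Carrier → F.Carrier → F.Carrier → Carrier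
  bilinearSum t s v = ∑F (λ y → ∑F (λ x → χ (x F.* (s F.+ t F.* y) F.+ v F.* y)))

  bilinearSum-inner : ∀ t s v → bilinearSum t s v ≈
    ∑F (λ y → 𝟙 ((s F.+ t F.* y) F.≟ F.0#) * (Q * χ (v F.* y)))
  bilinearSum-inner t s v = ∑F.∑-cong λ y → begin
    ∑F (λ x → χ (x F.* (s F.+ t F.* y) F.+ v F.* y))
      ≈⟨ ∑F.∑-cong (λ x → trans (χ-+ _ _) (*-congʳ (χ-cong (F.*-comm _ _)))) ⟩
    ∑F (λ x → χ ((s F.+ t F.* y) F.* x) * χ (v F.* y))
      ≈⟨ ∑F.∑-*ʳ _ _ ⟨
    ∑F (λ x → χ ((s F.+ t F.* y) F.* x)) * χ (v F.* y)
      ≈⟨ *-congʳ (trans (∑χ (s F.+ t F.* y)) (*-comm _ _)) ⟩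
    𝟙 ((s F.+ t F.* y) F.≟ F.0#) * Q * χ (v F.* y)
      ≈⟨ *-assoc _ _ _ ⟩
    𝟙 ((s F.+ t F.* y) F.≟ F.0#) * (Q * χ (v F.* y)) ∎

  -- Only y = -s/t survives the inner sum. This root is an argument so that the use at -t can supply
  -- it without a double sign.
  bilinearSum-≉0 : ∀ {t} s v y₀ → ¬ t F.≈ F.0# → s F.+ t F.* y₀ F.≈ F.0# →
                   bilinearSum t s v ≈ Q * χ (v F.* y₀)
  bilinearSum-≉0 {t} s v y₀ t≉0 root = trans (bilinearSum-inner t s v) (trans
    (∑F.∑-cong λ y → *-congʳ (𝟙-⇔ ((s F.+ t F.* y) F.≟ F.0#) (y F.≟ y₀)
      (λ eq → F.*-cancelˡ-≉0 t≉0 (F.+-cancelˡ s _ _ (F.trans eq (F.sym root))))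
      (λ y≈y₀ → F.trans (F.+-congˡ (F.*-congˡ y≈y₀)) root)))
    (∑F.∑-𝟙 (λ y → Q * χ (v F.* y)) y₀ (λ y → y F.≟ y₀) (λ y≈y₀ → *-congˡ (χ-cong (F.*-congˡ y≈y₀)))))

  bilinearSum-0 : ∀ {t} s v → t F.≈ F.0# →
                  bilinearSum t s v ≈ Q * 𝟙 (s F.≟ F.0#) * (Q * 𝟙 (v F.≟ F.0#))
  bilinearSum-0 {t} s v t≈0 = begin
    bilinearSum t s v
      ≈⟨ bilinearSum-inner t s v ⟩
    ∑F (λ y → 𝟙 ((s F.+ t F.* y) F.≟ F.0#) * (Q * χ (v F.* y)))
      ≈⟨ ∑F.∑-cong (λ y → trans (sym (*-assoc _ _ _)) (*-congʳ (trans (*-comm _ _) (*-congˡ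
           (𝟙-⇔ ((s F.+ t F.* y) F.≟ F.0#) (s F.≟ F.0#) (F.trans (F.sym (s+ty≈s y))) (F.trans (s+ty≈s y))))))) ⟩
    ∑F (λ y → Q * 𝟙 (s F.≟ F.0#) * χ (v F.* y))
      ≈⟨ ∑F.∑-*ˡ (Q * 𝟙 (s F.≟ F.0#)) _ ⟨
    Q * 𝟙 (s F.≟ F.0#) * ∑F (λ y → χ (v F.* y))
      ≈⟨ *-congˡ (∑χ v) ⟩
    Q * 𝟙 (s F.≟ F.0#) * (Q * 𝟙 (v F.≟ F.0#)) ∎
    where
    s+ty≈s : ∀ y → s F.+ t F.* y F.≈ s
    s+ty≈s y = F.trans (F.+-congˡ (F.trans (F.*-congʳ t≈0) (F.zeroˡ y))) (F.+-identityʳ s)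

  -- The matrix space and its exponential sums

  module Mat = Group (Mat₂ 𝔽)
  module Γ = Graph (specialUnitGraph 𝔽)

  module ∑M = FieldSums K Mat.setoid Γ.enumeration
  open ∑M using () renaming (∑ to ∑M; _≟S_ to _≟M_)

  n : ℕ
  n = Γ.order

  -- The enumeration of matrices is nested from four copies of that of the field, so `combine`
  -- unpacks it entry by entry, in row order.
  ∑M-entries : ∀ f → ∑M f ≈ ∑F λ a → ∑F λ b → ∑F λ c → ∑F λ d → f ((a , b) , (c , d))
  ∑M-entries f = begin
    ∑M f
      ≡⟨ ∑M.∑-sum f ⟩
    sum {n} (λ i → f (Γ.vertex i))
      ≈⟨ sum-combine (q ℕ.* q) {q ℕ.* q} _ ⟩
    sum {q ℕ.* q} (λ i → sum {q ℕ.* q} (λ j → f (Γ.vertex (combine i j))))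
      ≈⟨ sum-combine q {q} _ ⟩
    sum {q} (λ a → sum {q} (λ b → sum {q ℕ.* q} (λ j → f (Γ.vertex (combine (combine a b) j)))))
      ≈⟨ sum→∑ (λ a → sum→∑ λ b → trans (sum-combine q {q} _) (sum→∑ λ c → sum→∑ λ d →
           reflexive (≡.cong f (vertex-combine a b c d)))) ⟩
    (∑F λ a → ∑F λ b → ∑F λ c → ∑F λ d → f ((a , b) , (c , d))) ∎
    where
    from = Inverse.from F.enumeration
    sum→∑ : ∀ {t : Fin q → Carrier} {g} → (∀ i → t i ≈ g (from i)) → sum t ≈ ∑F g
    sum→∑ t≈g = trans (sum-cong {q} t≈g) (reflexive (≡.sym (∑F.∑-sum _)))
    vertex-combine : ∀ (a b c d : Fin q) → Γ.vertex (combine (combine a b) (combine c d)) ≡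
                     ((from a , from b) , (from c , from d))
    vertex-combine a b c d = ≡.trans
      (≡.cong (Product.map row row) (remQuot-combine (combine a b) (combine c d)))
      (≡.cong₂ _,_ (row-combine a b) (row-combine c d))
      where
      row : Fin (q ℕ.* q) → F.Carrier × F.Carrier
      row = Product.map from from ∘ remQuot q
      row-combine : ∀ (i j : Fin q) → row (combine i j) ≡ (from i , from j)
      row-combine i j = ≡.cong (Product.map from from) (remQuot-combine i j)

  -- The trace of MᵀX. Its symmetry later turns row orthogonality into column orthogonality.
  ⟨_,_⟩ : Mat.Carrier → Mat.Carrier → F.Carrier
  ⟨ ((s , β) , (γ , v)) , ((a , b) , (c , d)) ⟩ =
    (s F.* a F.+ β F.* b) F.+ (γ F.* c F.+ v F.* d)

  Δ : Mat.Carrier → F.Carrier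
  Δ = det 𝔽

  ⟨⟩-cong : ∀ {M N X Y} → M Mat.≈ N → X Mat.≈ Y → ⟨ M , X ⟩ F.≈ ⟨ N , Y ⟩
  ⟨⟩-cong ((s , β) , (γ , v)) ((a , b) , (c , d)) =
    F.+-cong (F.+-cong (F.*-cong s a) (F.*-cong β b)) (F.+-cong (F.*-cong γ c) (F.*-cong v d))

  ⟨⟩-comm : ∀ M X → ⟨ M , X ⟩ F.≈ ⟨ X , M ⟩
  ⟨⟩-comm _ _ = F.+-cong (F.+-cong (F.*-comm _ _) (F.*-comm _ _)) (F.+-cong (F.*-comm _ _) (F.*-comm _ _))

  ⟨⟩-∙ : ∀ M X Y → ⟨ M , X Mat.∙ Y ⟩ F.≈ ⟨ M , X ⟩ F.+ ⟨ M , Y ⟩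
  ⟨⟩-∙ ((s , β) , (γ , v)) ((a , b) , (c , d)) ((a′ , b′) , (c′ , d′)) =
    S.solve 12 (λ s β γ v a b c d a′ b′ c′ d′ →
        (s S.:* (a S.:+ a′) S.:+ β S.:* (b S.:+ b′)) S.:+ (γ S.:* (c S.:+ c′) S.:+ v S.:* (d S.:+ d′)) S.:=
        ((s S.:* a S.:+ β S.:* b) S.:+ (γ S.:* c S.:+ v S.:* d)) S.:+
        ((s S.:* a′ S.:+ β S.:* b′) S.:+ (γ S.:* c′ S.:+ v S.:* d′)))
      F.refl s β γ v a b c d a′ b′ c′ d′
    where module S = SemiringSolver (CommutativeRing.commutativeSemiring F.commutativeRing)

  ⟨⟩-⁻¹ : ∀ M X → ⟨ M Mat.⁻¹ , X ⟩ F.≈ ⟨ M , X Mat.⁻¹ ⟩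
  ⟨⟩-⁻¹ _ _ = F.+-cong (F.+-cong neg neg) (F.+-cong neg neg)
    where
    neg : ∀ {x y} → F.- x F.* y F.≈ x F.* F.- y
    neg = F.trans (F.sym (F.-‿distribˡ-* _ _)) (F.-‿distribʳ-* _ _)

  Δ-cong : ∀ {X Y} → X Mat.≈ Y → Δ X F.≈ Δ Y
  Δ-cong ((a , b) , (c , d)) = F.+-cong (F.*-cong a d) (F.-‿cong (F.*-cong b c))

  exponentialSum : F.Carrier → Mat.Carrier → F.Carrier → Carrier
  exponentialSum δ M t = ∑M (λ Z → χ (t F.* (δ F.- Δ Z) F.+ ⟨ M , Z ⟩))

  exponent : ∀ t δ s β γ v a b c d →
    t F.* (δ F.- (a F.* d F.- b F.* c)) F.+ ((s F.* a F.+ β F.* b) F.+ (γ F.* c F.+ v F.* d)) F.≈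
    t F.* δ F.+ ((a F.* (s F.+ F.- t F.* d) F.+ v F.* d) F.+ (b F.* (β F.+ t F.* c) F.+ γ F.* c))
  exponent t δ s β γ v a b c d = F.trans
    (F.+-congʳ (F.trans (F.x[y-z]≈xy-xz t δ _) (F.+-congˡ negated)))
    -- The semiring solver sees -t as an independent variable t′, since `negated` has moved every
    -- minus sign onto t.
    (S.solve 11 (λ t t′ δ s β γ v a b c d →
        (t S.:* δ S.:+ (t S.:* (b S.:* c) S.:+ t′ S.:* (a S.:* d))) S.:+
          ((s S.:* a S.:+ β S.:* b) S.:+ (γ S.:* c S.:+ v S.:* d)) S.:=
        t S.:* δ S.:+ ((a S.:* (s S.:+ t′ S.:* d) S.:+ v S.:* d) S.:+ (b S.:* (β S.:+ t S.:* c) S.:+ γ S.:* c)))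
      F.refl t (F.- t) δ s β γ v a b c d)
    where
    module S = SemiringSolver (CommutativeRing.commutativeSemiring F.commutativeRing)
    negated : F.- (t F.* (a F.* d F.- b F.* c)) F.≈ t F.* (b F.* c) F.+ F.- t F.* (a F.* d)
    negated = F.trans (F.-‿cong (F.x[y-z]≈xy-xz t _ _))
      (F.trans (GroupProperties.⁻¹-anti-homo-// F.+-group _ _) (F.+-congˡ (F.-‿distribˡ-* _ _)))

  ∑-product : ∀ k (G H : F.Carrier → F.Carrier → Carrier) →
    (∑F λ a → ∑F λ b → ∑F λ c → ∑F λ d → k * (G a d * H b c)) ≈
    k * (∑F (λ d → ∑F λ a → G a d) * ∑F (λ c → ∑F λ b → H b c))
  ∑-product k G H = begin
    (∑F λ a → ∑F λ b → ∑F λ c → ∑F λ d → k * (G a d * H b c))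
      ≈⟨ ∑F.∑-cong (λ a → ∑F.∑-cong λ b → ∑F.∑-cong λ c → pullˡ _ _) ⟩
    (∑F λ a → ∑F λ b → ∑F λ c → k * (∑F (G a) * H b c))
      ≈⟨ ∑F.∑-cong (λ a → ∑F.∑-cong λ b → pullʳ _ _) ⟩
    (∑F λ a → ∑F λ b → k * (∑F (G a) * ∑F (H b)))
      ≈⟨ ∑F.∑-cong (λ a → pullʳ _ _) ⟩
    (∑F λ a → k * (∑F (G a) * ∑F (λ b → ∑F (H b))))
      ≈⟨ pullˡ _ _ ⟩
    k * (∑F (λ a → ∑F (G a)) * ∑F (λ b → ∑F (H b)))
      ≈⟨ *-congˡ (*-cong (∑-swap F.enumeration F.enumeration G) (∑-swap F.enumeration F.enumeration H)) ⟩
    k * (∑F (λ d → ∑F λ a → G a d) * ∑F (λ c → ∑F λ b → H b c)) ∎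
    where
    pullˡ : ∀ f y → ∑F (λ x → k * (f x * y)) ≈ k * (∑F f * y)
    pullˡ f y = sym (trans (*-congˡ (∑F.∑-*ʳ y f)) (∑F.∑-*ˡ k _))
    pullʳ : ∀ y f → ∑F (λ x → k * (y * f x)) ≈ k * (y * ∑F f)
    pullʳ y f = sym (trans (*-congˡ (∑F.∑-*ˡ y f)) (∑F.∑-*ˡ k _))

  exponentialSum-factor : ∀ δ s β γ v t → exponentialSum δ ((s , β) , (γ , v)) t ≈
    χ (t F.* δ) * (bilinearSum (F.- t) s v * bilinearSum t β γ)
  exponentialSum-factor δ s β γ v t = begin
    exponentialSum δ ((s , β) , (γ , v)) t
      ≈⟨ ∑M-entries _ ⟩
    (∑F λ a → ∑F λ b → ∑F λ c → ∑F λ d →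
      χ (t F.* (δ F.- Δ ((a , b) , (c , d))) F.+ ⟨ ((s , β) , (γ , v)) , ((a , b) , (c , d)) ⟩))
      ≈⟨ ∑F.∑-cong (λ a → ∑F.∑-cong λ b → ∑F.∑-cong λ c → ∑F.∑-cong λ d →
           trans (χ-cong (exponent t δ s β γ v a b c d))
                 (trans (χ-+ _ _) (*-congˡ (χ-+ _ _)))) ⟩
    (∑F λ a → ∑F λ b → ∑F λ c → ∑F λ d → χ (t F.* δ) *
      (χ (a F.* (s F.+ F.- t F.* d) F.+ v F.* d) * χ (b F.* (β F.+ t F.* c) F.+ γ F.* c)))
      ≈⟨ ∑-product (χ (t F.* δ)) (λ a d → χ (a F.* (s F.+ F.- t F.* d) F.+ v F.* d))
                                 (λ b c → χ (b F.* (β F.+ t F.* c) F.+ γ F.* c)) ⟩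
    χ (t F.* δ) * (bilinearSum (F.- t) s v * bilinearSum t β γ) ∎

  -- At t = 0 the determinant drops out and each of the four entries contributes Q and an indicator.
  -- The same identity gives the orthogonality of the characters.
  exponentialSum-0 : ∀ δ M → exponentialSum δ M F.0# ≈ Q ^ 4 * 𝟙 (M ≟M Mat.ε)
  exponentialSum-0 δ M@((s , β) , (γ , v)) = begin
    exponentialSum δ M F.0#
      ≈⟨ exponentialSum-factor δ s β γ v F.0# ⟩
    χ (F.0# F.* δ) * (bilinearSum (F.- F.0#) s v * bilinearSum F.0# β γ)
      ≈⟨ *-cong (trans (χ-cong (F.zeroˡ δ)) χ-0)
           (*-cong (bilinearSum-0 s v F.-0#≈0#) (bilinearSum-0 β γ F.refl)) ⟩
    1# * (Q * 𝟙 (s F.≟ F.0#) * (Q * 𝟙 (v F.≟ F.0#)) * (Q * 𝟙 (β F.≟ F.0#) * (Q * 𝟙 (γ F.≟ F.0#))))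
      ≈⟨ solve 5 (λ Q s v β γ → con 1 :* (Q :* s :* (Q :* v) :* (Q :* β :* (Q :* γ))) :=
           (Q :* (Q :* (Q :* (Q :* con 1)))) :* ((s :* β) :* (γ :* v))) refl Q _ _ _ _ ⟩
    Q ^ 4 * ((𝟙 (s F.≟ F.0#) * 𝟙 (β F.≟ F.0#)) * (𝟙 (γ F.≟ F.0#) * 𝟙 (v F.≟ F.0#)))
      ≈⟨ *-congˡ (*-cong (𝟙-× (s F.≟ F.0#) (β F.≟ F.0#) ((s F.≟ F.0#) ×-dec (β F.≟ F.0#)) _,_ id)
                         (𝟙-× (γ F.≟ F.0#) (v F.≟ F.0#) ((γ F.≟ F.0#) ×-dec (v F.≟ F.0#)) _,_ id)) ⟩
    Q ^ 4 * (𝟙 ((s F.≟ F.0#) ×-dec (β F.≟ F.0#)) * 𝟙 ((γ F.≟ F.0#) ×-dec (v F.≟ F.0#)))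
      ≈⟨ *-congˡ (𝟙-× ((s F.≟ F.0#) ×-dec (β F.≟ F.0#)) ((γ F.≟ F.0#) ×-dec (v F.≟ F.0#)) (M ≟M Mat.ε) _,_ id) ⟩
    Q ^ 4 * 𝟙 (M ≟M Mat.ε) ∎

  -- The diagonal pair contributes Q χ(vs/t) and the other pair Q χ(-γβ/t); the exponents add up to
  -- det M / t.
  exponentialSum-≉0 : ∀ δ M {t} → ¬ t F.≈ F.0# →
    exponentialSum δ M t ≈ Q ^ 2 * χ (t F.* δ F.+ Δ M F.* t F.⁻¹)
  exponentialSum-≉0 δ M@((s , β) , (γ , v)) {t} t≉0 = begin
    exponentialSum δ M t
      ≈⟨ exponentialSum-factor δ s β γ v t ⟩
    χ (t F.* δ) * (bilinearSum (F.- t) s v * bilinearSum t β γ)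
      ≈⟨ *-congˡ (*-cong
           (bilinearSum-≉0 s v (s F.* t⁻¹) (t≉0 ∘ -t≈0⇒t≈0) (F.trans (F.+-congˡ (F.sym (F.-‿distribˡ-* t _)))
              (F.x≈y⇒x-y≈0 (F.sym (t*xt⁻¹ s)))))
           (bilinearSum-≉0 β γ (F.- (β F.* t⁻¹)) t≉0 (F.trans (F.+-congˡ (F.sym (F.-‿distribʳ-* t _)))
              (F.x≈y⇒x-y≈0 (F.sym (t*xt⁻¹ β)))))) ⟩
    χ (t F.* δ) * (Q * χ (v F.* (s F.* t⁻¹)) * (Q * χ (γ F.* F.- (β F.* t⁻¹))))
      ≈⟨ solve 4 (λ Q x y z → x :* (Q :* y :* (Q :* z)) := (Q :* (Q :* con 1)) :* (x :* (y :* z))) refl Q _ _ _ ⟩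
    Q ^ 2 * (χ (t F.* δ) * (χ (v F.* (s F.* t⁻¹)) * χ (γ F.* F.- (β F.* t⁻¹))))
      ≈⟨ *-congˡ (trans (χ-+ _ _) (*-congˡ (χ-+ _ _))) ⟨
    Q ^ 2 * χ (t F.* δ F.+ (v F.* (s F.* t⁻¹) F.+ γ F.* F.- (β F.* t⁻¹)))
      ≈⟨ *-congˡ (χ-cong (F.+-congˡ determinant)) ⟩
    Q ^ 2 * χ (t F.* δ F.+ Δ M F.* t⁻¹) ∎
    where
    t⁻¹ = t F.⁻¹
    -t≈0⇒t≈0 : F.- t F.≈ F.0# → t F.≈ F.0#
    -t≈0⇒t≈0 -t≈0 = F.trans (F.sym (F.-‿involutive t)) (F.trans (F.-‿cong -t≈0) F.-0#≈0#)
    t*xt⁻¹ : ∀ x → t F.* (x F.* t⁻¹) F.≈ x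
    t*xt⁻¹ x = F.trans (CommutativeSemigroupProperties.x∙yz≈y∙xz F.*-commutativeSemigroup t x t⁻¹)
      (F.trans (F.*-congˡ (F.⁻¹-inverse t≉0)) (F.*-identityʳ x))
    determinant : v F.* (s F.* t⁻¹) F.+ γ F.* F.- (β F.* t⁻¹) F.≈ Δ M F.* t⁻¹
    determinant = F.trans
      (F.+-cong (F.trans (F.sym (F.*-assoc v s t⁻¹)) (F.*-congʳ (F.*-comm v s)))
        (F.trans (F.sym (F.-‿distribʳ-* γ _)) (F.-‿cong (F.trans (F.sym (F.*-assoc γ β t⁻¹)) (F.*-congʳ (F.*-comm γ β))))))
      (F.sym (F.[y-z]x≈yx-zx t⁻¹ _ _))

  -- Kloosterman sums, level counts and eigenvalues

  kloosterman : F.Carrier → F.Carrier → Carrier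
  kloosterman δ ε = sumOver nonzeroElements (λ t → χ (t F.* δ F.+ ε F.* t F.⁻¹))

  levelSum : F.Carrier → Mat.Carrier → Carrier
  levelSum δ M = ∑M (λ Z → 𝟙 (Δ Z F.≟ δ) * χ ⟨ M , Z ⟩)

  levelSum≈kloosterman : ∀ δ M → levelSum δ M ≈ Q ^ 3 * 𝟙 (M ≟M Mat.ε) + Q * kloosterman δ (Δ M)
  levelSum≈kloosterman δ M = *-cancelˡ-≉0 Q≉0 (begin
    Q * levelSum δ M
      ≈⟨ ∑M.∑-*ˡ Q _ ⟩
    ∑M (λ Z → Q * (𝟙 (Δ Z F.≟ δ) * χ ⟨ M , Z ⟩))
      ≈⟨ ∑M.∑-cong detect ⟩
    ∑M (λ Z → ∑F (λ t → χ (t F.* (δ F.- Δ Z) F.+ ⟨ M , Z ⟩)))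
      ≈⟨ ∑-swap Γ.enumeration F.enumeration (λ Z t → χ (t F.* (δ F.- Δ Z) F.+ ⟨ M , Z ⟩)) ⟩
    ∑F (exponentialSum δ M)
      ≈⟨ ∑-zero+nonzero (exponentialSum δ M) (λ t≈0 → ∑M.∑-cong λ Z → χ-cong (F.+-congʳ (F.*-congʳ t≈0))) ⟩
    exponentialSum δ M F.0# + sumOver nonzeroElements (exponentialSum δ M)
      ≈⟨ +-cong (exponentialSum-0 δ M) (sumOver-nonzero-cong (exponentialSum-≉0 δ M)) ⟩
    Q ^ 4 * 𝟙 (M ≟M Mat.ε) + sumOver nonzeroElements (λ t → Q ^ 2 * χ (t F.* δ F.+ Δ M F.* t F.⁻¹))
      ≈⟨ +-congˡ (sumOver-*ˡ nonzeroElements (Q ^ 2) _) ⟨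
    Q ^ 4 * 𝟙 (M ≟M Mat.ε) + Q ^ 2 * kloosterman δ (Δ M)
      ≈⟨ solve 3 (λ Q i k → (Q :* (Q :* (Q :* (Q :* con 1)))) :* i :+ (Q :* (Q :* con 1)) :* k :=
           Q :* ((Q :* (Q :* (Q :* con 1))) :* i :+ Q :* k)) refl Q _ _ ⟩
    Q * (Q ^ 3 * 𝟙 (M ≟M Mat.ε) + Q * kloosterman δ (Δ M)) ∎)
    where
    detect : ∀ Z → Q * (𝟙 (Δ Z F.≟ δ) * χ ⟨ M , Z ⟩) ≈ ∑F (λ t → χ (t F.* (δ F.- Δ Z) F.+ ⟨ M , Z ⟩))
    detect Z = begin
      Q * (𝟙 (Δ Z F.≟ δ) * χ ⟨ M , Z ⟩)
        ≈⟨ *-assoc _ _ _ ⟨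
      Q * 𝟙 (Δ Z F.≟ δ) * χ ⟨ M , Z ⟩
        ≈⟨ *-congʳ (*-congˡ (𝟙-⇔ (Δ Z F.≟ δ) ((δ F.- Δ Z) F.≟ F.0#)
             (F.x≈y⇒x-y≈0 ∘ F.sym) (F.sym ∘ F.x-y≈0⇒x≈y _ _))) ⟩
      Q * 𝟙 ((δ F.- Δ Z) F.≟ F.0#) * χ ⟨ M , Z ⟩
        ≈⟨ *-congʳ (∑χ (δ F.- Δ Z)) ⟨
      ∑F (λ t → χ ((δ F.- Δ Z) F.* t)) * χ ⟨ M , Z ⟩
        ≈⟨ ∑F.∑-*ʳ _ _ ⟩
      ∑F (λ t → χ ((δ F.- Δ Z) F.* t) * χ ⟨ M , Z ⟩)
        ≈⟨ ∑F.∑-cong (λ t → trans (χ-+ _ _) (*-congʳ (χ-cong (F.*-comm _ _)))) ⟨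
      ∑F (λ t → χ (t F.* (δ F.- Δ Z) F.+ ⟨ M , Z ⟩)) ∎

  -- Spelled exactly as μ in the theorem, so that `spectrum` is the stated list by computation.
  λ-kloosterman : F.Carrier → Carrier
  λ-kloosterman ε = Q * sumOver nonzeroElements (λ α → χ (α F.+ ε F.* α F.⁻¹))

  λ-kloosterman-cong : ∀ {ε ε′} → ε F.≈ ε′ → λ-kloosterman ε ≈ λ-kloosterman ε′
  λ-kloosterman-cong ε≈ε′ =
    *-congˡ (sumOver-cong nonzeroElements λ α → χ-cong (F.+-congˡ (F.*-congʳ ε≈ε′)))

  Q*kloosterman-1 : ∀ ε → Q * kloosterman F.1# ε ≈ λ-kloosterman ε
  Q*kloosterman-1 ε =
    *-congˡ (sumOver-cong nonzeroElements λ α → χ-cong (F.+-congʳ (F.*-identityʳ α)))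

  -- For ε = 0 the summand is χ(δt), and the missing term t = 0 completes a full character sum; the
  -- Q on the left is that term. The case δ = 1 gives the eigenvalue -q, general δ the level counts.
  kloosterman-0 : ∀ δ {ε} → ε F.≈ F.0# → Q * kloosterman δ ε + Q ≈ Q ^ 2 * 𝟙 (δ F.≟ F.0#)
  kloosterman-0 δ {ε} ε≈0 = begin
    Q * kloosterman δ ε + Q
      ≈⟨ solve 2 (λ Q k → Q :* k :+ Q := Q :* (con 1 :+ k)) refl Q _ ⟩
    Q * (1# + kloosterman δ ε)
      ≈⟨ *-congˡ (+-cong (trans (χ-cong (F.zeroʳ δ)) χ-0)
           (sumOver-cong nonzeroElements λ t → χ-cong (F.trans (F.*-comm δ t) (F.sym
             (F.trans (F.+-congˡ (F.trans (F.*-congʳ ε≈0) (F.zeroˡ _))) (F.+-identityʳ _)))))) ⟨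
    Q * (χ (δ F.* F.0#) + sumOver nonzeroElements (λ t → χ (δ F.* t)))
      ≈⟨ *-congˡ (∑-zero+nonzero (λ t → χ (δ F.* t)) (λ t≈0 → χ-cong (F.*-congˡ t≈0))) ⟨
    Q * ∑F (λ t → χ (δ F.* t))
      ≈⟨ *-congˡ (∑χ δ) ⟩
    Q * (Q * 𝟙 (δ F.≟ F.0#))
      ≈⟨ solve 2 (λ Q i → Q :* (Q :* i) := (Q :* (Q :* con 1)) :* i) refl Q _ ⟩
    Q ^ 2 * 𝟙 (δ F.≟ F.0#) ∎

  λ-kloosterman-0 : ∀ {ε} → ε F.≈ F.0# → λ-kloosterman ε ≈ - Q
  λ-kloosterman-0 {ε} ε≈0 = +-inverseˡ-unique _ _ (begin
    λ-kloosterman ε + Q              ≈⟨ +-congʳ (Q*kloosterman-1 ε) ⟨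
    Q * kloosterman F.1# ε + Q       ≈⟨ kloosterman-0 F.1# ε≈0 ⟩
    Q ^ 2 * 𝟙 (F.1# F.≟ F.0#)        ≈⟨ *-congˡ (𝟙-no (F.1# F.≟ F.0#) F.1≉0) ⟩
    Q ^ 2 * 0#                       ≈⟨ zeroʳ _ ⟩
    0#                               ∎)

  Δ-ε : Δ Mat.ε F.≈ F.0#
  Δ-ε = F.-‿inverseʳ _

  ⟨ε,⟩ : ∀ X → ⟨ Mat.ε , X ⟩ F.≈ F.0#
  ⟨ε,⟩ X = F.x+x≈x⇒x≈0 _ (F.sym (F.trans (⟨⟩-comm Mat.ε X) (F.trans
    (⟨⟩-cong (Mat.refl {X}) (Mat.sym (Mat.identityˡ Mat.ε)))
    (F.trans (⟨⟩-∙ X Mat.ε Mat.ε) (F.+-cong (⟨⟩-comm X Mat.ε) (⟨⟩-comm X Mat.ε))))))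

  levelCount : F.Carrier → Carrier
  levelCount δ = ∑M (λ Z → 𝟙 (Δ Z F.≟ δ))

  -- At M = 0 every character value is 1, so the eigenvalue formula becomes a count.
  levelCount+Q : ∀ δ → levelCount δ + Q ≈ Q ^ 3 + Q ^ 2 * 𝟙 (δ F.≟ F.0#)
  levelCount+Q δ = begin
    levelCount δ + Q
      ≈⟨ +-congʳ (∑M.∑-cong λ Z → trans (*-congˡ (trans (χ-cong (⟨ε,⟩ Z)) χ-0)) (*-identityʳ _)) ⟨
    levelSum δ Mat.ε + Q
      ≈⟨ +-congʳ (levelSum≈kloosterman δ Mat.ε) ⟩
    Q ^ 3 * 𝟙 (Mat.ε ≟M Mat.ε) + Q * kloosterman δ (Δ Mat.ε) + Q
      ≈⟨ +-assoc _ _ _ ⟩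
    Q ^ 3 * 𝟙 (Mat.ε ≟M Mat.ε) + (Q * kloosterman δ (Δ Mat.ε) + Q)
      ≈⟨ +-cong (trans (*-congˡ (𝟙-yes (Mat.ε ≟M Mat.ε) Mat.refl)) (*-identityʳ _)) (kloosterman-0 δ Δ-ε) ⟩
    Q ^ 3 + Q ^ 2 * 𝟙 (δ F.≟ F.0#) ∎

  eigenvalue : Mat.Carrier → Carrier
  eigenvalue = levelSum F.1#

  eigenvalue-ε : ∀ {M} → M Mat.≈ Mat.ε → eigenvalue M ≈ Q ^ 3 - Q
  eigenvalue-ε {M} M≈ε = trans (levelSum≈kloosterman F.1# M) (+-cong
    (trans (*-congˡ (𝟙-yes (M ≟M Mat.ε) M≈ε)) (*-identityʳ _))
    (trans (Q*kloosterman-1 _) (λ-kloosterman-0 (F.trans (Δ-cong M≈ε) Δ-ε))))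

  eigenvalue-≉ε : ∀ {M} → ¬ M Mat.≈ Mat.ε → eigenvalue M ≈ λ-kloosterman (Δ M)
  eigenvalue-≉ε {M} M≉ε = trans (levelSum≈kloosterman F.1# M) (trans
    (+-cong (trans (*-congˡ (𝟙-no (M ≟M Mat.ε) M≉ε)) (zeroʳ _)) (Q*kloosterman-1 _))
    (+-identityˡ _))

  -- Multiplicities and the list of eigenvalues

  N₀ N₁ : ℕ
  N₀ = q ℕ.^ 3 ℕ.+ q ℕ.^ 2 ∸ q ∸ 1
  N₁ = q ℕ.^ 3 ∸ q

  spectrum : List Carrier
  spectrum = (Q ^ 3 - Q) ∷ replicate N₀ (- Q)
             ++ concatMap (λ δ → replicate N₁ (λ-kloosterman δ)) nonzeroElements

  fromℕ-∸ : ∀ {i j} → i ≤ j → fromℕ (j ∸ i) + fromℕ i ≈ fromℕ j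
  fromℕ-∸ {i} {j} i≤j = trans (sym (×-homo-+ 1# (j ∸ i) i)) (×-congˡ (ℕ.m∸n+n≡m i≤j))

  q≤q³ : q ≤ q ℕ.^ 3
  q≤q³ = ℕ.m≤m*n q (q ℕ.^ 2) {{ℕ.m^n≢0 q 2 {{ℕ.>-nonZero F.q>0}}}}

  levelCount-≉0 : ∀ {δ} → ¬ δ F.≈ F.0# → levelCount δ ≈ fromℕ N₁
  levelCount-≉0 {δ} δ≉0 = +-cancelʳ Q _ _ (begin
    levelCount δ + Q                 ≈⟨ levelCount+Q δ ⟩
    Q ^ 3 + Q ^ 2 * 𝟙 (δ F.≟ F.0#)   ≈⟨ +-congˡ (trans (*-congˡ (𝟙-no (δ F.≟ F.0#) δ≉0)) (zeroʳ _)) ⟩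
    Q ^ 3 + 0#                       ≈⟨ +-identityʳ _ ⟩
    Q ^ 3                            ≈⟨ fromℕ-^ q 3 ⟨
    fromℕ (q ℕ.^ 3)                  ≈⟨ fromℕ-∸ q≤q³ ⟨
    fromℕ N₁ + Q                     ∎)

  -- The 1 is the zero matrix, which is singular but has an eigenvalue of its own; `N₀` counts the
  -- nonzero singular matrices.
  levelCount-0 : levelCount F.0# ≈ 1# + fromℕ N₀
  levelCount-0 = +-cancelʳ Q _ _ (begin
    levelCount F.0# + Q
      ≈⟨ levelCount+Q F.0# ⟩
    Q ^ 3 + Q ^ 2 * 𝟙 (F.0# F.≟ F.0#)
      ≈⟨ +-congˡ (trans (*-congˡ (𝟙-yes (F.0# F.≟ F.0#) F.refl)) (*-identityʳ _)) ⟩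
    Q ^ 3 + Q ^ 2
      ≈⟨ +-cong (fromℕ-^ q 3) (fromℕ-^ q 2) ⟨
    fromℕ (q ℕ.^ 3) + fromℕ (q ℕ.^ 2)
      ≈⟨ ×-homo-+ 1# (q ℕ.^ 3) (q ℕ.^ 2) ⟨
    fromℕ (q ℕ.^ 3 ℕ.+ q ℕ.^ 2)
      ≈⟨ fromℕ-∸ q+1≤ ⟨
    fromℕ (q ℕ.^ 3 ℕ.+ q ℕ.^ 2 ∸ (q ℕ.+ 1)) + fromℕ (q ℕ.+ 1)
      ≈⟨ +-cong (×-congˡ (≡.sym (ℕ.∸-+-assoc (q ℕ.^ 3 ℕ.+ q ℕ.^ 2) q 1))) (×-homo-+ 1# q 1) ⟩
    fromℕ N₀ + (Q + (1# + 0#))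
      ≈⟨ solve 2 (λ n Q → n :+ (Q :+ (con 1 :+ con 0)) := con 1 :+ n :+ Q) refl (fromℕ N₀) Q ⟩
    1# + fromℕ N₀ + Q ∎)
    where
    -- With q ≤ q³ and 1 ≤ q², the truncated subtractions in `N₀` are exact.
    q+1≤ : q ℕ.+ 1 ≤ q ℕ.^ 3 ℕ.+ q ℕ.^ 2
    q+1≤ = ℕ.+-mono-≤ q≤q³ (ℕ.>-nonZero⁻¹ (q ℕ.^ 2) {{ℕ.m^n≢0 q 2 {{ℕ.>-nonZero F.q>0}}}})

  sum-by-determinant : ∀ f → (∀ {δ ε} → δ F.≈ ε → f δ ≈ f ε) →
    ∑M (f ∘ Δ) ≈ levelCount F.0# * f F.0# + sumOver nonzeroElements (λ δ → levelCount δ * f δ)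
  sum-by-determinant f f-cong = begin
    ∑M (f ∘ Δ)
      ≈⟨ ∑M.∑-cong (λ Z → trans
           (∑F.∑-cong λ δ → *-congʳ (𝟙-⇔ (Δ Z F.≟ δ) (δ F.≟ Δ Z) F.sym F.sym))
           (∑F.∑-𝟙 f (Δ Z) (λ δ → δ F.≟ Δ Z) f-cong)) ⟨
    ∑M (λ Z → ∑F (λ δ → 𝟙 (Δ Z F.≟ δ) * f δ))
      ≈⟨ ∑-swap Γ.enumeration F.enumeration (λ Z δ → 𝟙 (Δ Z F.≟ δ) * f δ) ⟩
    ∑F (λ δ → ∑M (λ Z → 𝟙 (Δ Z F.≟ δ) * f δ))
      ≈⟨ ∑F.∑-cong (λ δ → ∑M.∑-*ʳ (f δ) _) ⟨
    ∑F (λ δ → levelCount δ * f δ)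
      ≈⟨ ∑-zero+nonzero (λ δ → levelCount δ * f δ) (λ {δ} δ≈0 → *-cong
           (∑M.∑-cong λ Z → 𝟙-⇔ (Δ Z F.≟ δ) (Δ Z F.≟ F.0#)
             (λ eq → F.trans eq δ≈0) (λ eq → F.trans eq (F.sym δ≈0)))
           (f-cong δ≈0)) ⟩
    levelCount F.0# * f F.0# + sumOver nonzeroElements (λ δ → levelCount δ * f δ) ∎

  -- Testing against every g identifies the list with the eigenvalues up to order, whatever
  -- coincidences occur among them.
  sumOver-spectrum : ∀ g → (∀ {x y} → x ≈ y → g x ≈ g y) → sumOver spectrum g ≈ ∑M (g ∘ eigenvalue)
  sumOver-spectrum g g-cong = begin
    sumOver spectrum g
      ≈⟨ +-congˡ (trans (sumOver-++ (replicate N₀ (- Q)) _ g) (+-cong (sumOver-replicate N₀ (- Q) g)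
           (trans (sumOver-concatMap (λ δ → replicate N₁ (λ-kloosterman δ)) nonzeroElements g)
             (sumOver-cong nonzeroElements λ δ → sumOver-replicate N₁ (λ-kloosterman δ) g)))) ⟩
    g (Q ^ 3 - Q) + (fromℕ N₀ * g (- Q) + rest)
      ≈⟨ +-cong (g-cong (eigenvalue-ε Mat.refl)) (+-cancelˡ (g (- Q)) _ _ nonzero-part) ⟨
    g (eigenvalue Mat.ε) + ∑M (λ M → 𝟙 (¬? (M ≟M Mat.ε)) * g (eigenvalue M))
      ≈⟨ ∑M.∑-split (g ∘ eigenvalue) Mat.ε (λ M → M ≟M Mat.ε)
           (λ M≈ε → g-cong (trans (eigenvalue-ε M≈ε) (sym (eigenvalue-ε Mat.refl)))) ⟨
    ∑M (g ∘ eigenvalue) ∎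
    where
    f : F.Carrier → Carrier
    f = g ∘ λ-kloosterman
    f-cong : ∀ {δ ε} → δ F.≈ ε → f δ ≈ f ε
    f-cong = g-cong ∘ λ-kloosterman-cong
    rest : Carrier
    rest = sumOver nonzeroElements (λ δ → fromℕ N₁ * f δ)
    punctured : ∀ M → 𝟙 (¬? (M ≟M Mat.ε)) * g (eigenvalue M) ≈ 𝟙 (¬? (M ≟M Mat.ε)) * f (Δ M)
    punctured M = 𝟙-*-congˡ (¬? (M ≟M Mat.ε)) (λ M≉ε → g-cong (eigenvalue-≉ε M≉ε))
    -- The term g(-Q), which the determinant alone would assign to the zero matrix, completes the
    -- sum to all matrices; it is then grouped by determinant, and the extra term is cancelled by
    -- the caller.
    nonzero-part : g (- Q) + ∑M (λ M → 𝟙 (¬? (M ≟M Mat.ε)) * g (eigenvalue M)) ≈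
                   g (- Q) + (fromℕ N₀ * g (- Q) + rest)
    nonzero-part = begin
      g (- Q) + ∑M (λ M → 𝟙 (¬? (M ≟M Mat.ε)) * g (eigenvalue M))
        ≈⟨ +-cong (g-cong (sym (λ-kloosterman-0 Δ-ε))) (∑M.∑-cong punctured) ⟩
      f (Δ Mat.ε) + ∑M (λ M → 𝟙 (¬? (M ≟M Mat.ε)) * f (Δ M))
        ≈⟨ ∑M.∑-split (f ∘ Δ) Mat.ε (λ M → M ≟M Mat.ε) (f-cong ∘ Δ-cong) ⟨
      ∑M (f ∘ Δ)
        ≈⟨ sum-by-determinant f f-cong ⟩
      levelCount F.0# * f F.0# + sumOver nonzeroElements (λ δ → levelCount δ * f δ)
        ≈⟨ +-cong (*-cong levelCount-0 (g-cong (λ-kloosterman-0 F.refl)))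
             (sumOver-nonzero-cong (λ δ≉0 → *-congʳ (levelCount-≉0 δ≉0))) ⟩
      (1# + fromℕ N₀) * g (- Q) + rest
        ≈⟨ solve 3 (λ n g r → (con 1 :+ n) :* g :+ r := g :+ (n :* g :+ r)) refl (fromℕ N₀) _ _ ⟩
      g (- Q) + (fromℕ N₀ * g (- Q) + rest) ∎

  -- Orthogonality and the eigenbasis

  ∑χ⟨⟩ : ∀ M → ∑M (λ X → χ ⟨ M , X ⟩) ≈ Q ^ 4 * 𝟙 (M ≟M Mat.ε)
  ∑χ⟨⟩ M = trans
    (∑M.∑-cong λ X → χ-cong (F.sym (F.trans (F.+-congʳ (F.zeroˡ _)) (F.+-identityˡ _))))
    (exponentialSum-0 F.0# M)

  orthogonality : ∀ M N → ∑M (λ X → χ ⟨ M , X ⟩ * χ ⟨ N Mat.⁻¹ , X ⟩) ≈ Q ^ 4 * 𝟙 (M ≟M N)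
  orthogonality M N = begin
    ∑M (λ X → χ ⟨ M , X ⟩ * χ ⟨ N Mat.⁻¹ , X ⟩)
      ≈⟨ ∑M.∑-cong (λ X → trans (sym (χ-+ _ _)) (χ-cong (F.sym (difference X)))) ⟩
    ∑M (λ X → χ ⟨ M Mat.// N , X ⟩)
      ≈⟨ ∑χ⟨⟩ (M Mat.// N) ⟩
    Q ^ 4 * 𝟙 ((M Mat.// N) ≟M Mat.ε)
      ≈⟨ *-congˡ (𝟙-⇔ ((M Mat.// N) ≟M Mat.ε) (M ≟M N) (MatP.x∙y⁻¹≈ε⇒x≈y M N) MatP.x≈y⇒x∙y⁻¹≈ε) ⟩
    Q ^ 4 * 𝟙 (M ≟M N) ∎
    where
    module MatP = GroupProperties (Mat₂ 𝔽)
    difference : ∀ X → ⟨ M Mat.// N , X ⟩ F.≈ ⟨ M , X ⟩ F.+ ⟨ N Mat.⁻¹ , X ⟩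
    difference X = F.trans (⟨⟩-comm _ X) (F.trans (⟨⟩-∙ X M (N Mat.⁻¹)) (F.+-cong (⟨⟩-comm X M) (⟨⟩-comm X (N Mat.⁻¹))))

  -- With Z = Y - X the adjacency operator becomes a convolution, and χ⟨M,Z + X⟩ factors.
  adjacency-χ : ∀ M X → ∑M (λ Y → 𝟙 (Δ (Y Mat.// X) F.≟ F.1#) * χ ⟨ M , Y ⟩) ≈ eigenvalue M * χ ⟨ M , X ⟩
  adjacency-χ M X = begin
    ∑M (λ Y → 𝟙 (Δ (Y Mat.// X) F.≟ F.1#) * χ ⟨ M , Y ⟩)
      ≈⟨ ∑M.∑-cong (λ Y → *-congˡ (χ-cong (⟨⟩-cong (Mat.refl {M}) (MatP.//-rightDividesˡ X Y)))) ⟨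
    ∑M (λ Y → 𝟙 (Δ (Y Mat.// X) F.≟ F.1#) * χ ⟨ M , (Y Mat.// X) Mat.∙ X ⟩)
      ≈⟨ ∑M.∑-bijection (λ Z → 𝟙 (Δ Z F.≟ F.1#) * χ ⟨ M , Z Mat.∙ X ⟩)
           (λ {Y} {Z} Y≈Z → *-cong
             (𝟙-⇔ (Δ Y F.≟ F.1#) (Δ Z F.≟ F.1#) (F.trans (F.sym (Δ-cong Y≈Z))) (F.trans (Δ-cong Y≈Z)))
             (χ-cong (⟨⟩-cong (Mat.refl {M}) (Mat.∙-congʳ Y≈Z))))
           (translation (Mat₂ 𝔽) (X Mat.⁻¹)) ⟩
    ∑M (λ Z → 𝟙 (Δ Z F.≟ F.1#) * χ ⟨ M , Z Mat.∙ X ⟩)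
      ≈⟨ ∑M.∑-cong (λ Z → trans (*-congˡ (trans (χ-cong (⟨⟩-∙ M Z X)) (χ-+ _ _))) (sym (*-assoc _ _ _))) ⟩
    ∑M (λ Z → 𝟙 (Δ Z F.≟ F.1#) * χ ⟨ M , Z ⟩ * χ ⟨ M , X ⟩)
      ≈⟨ ∑M.∑-*ʳ _ _ ⟨
    eigenvalue M * χ ⟨ M , X ⟩ ∎
    where module MatP = GroupProperties (Mat₂ 𝔽)

  open LinearAlgebra K

  A : SquareMatrix n
  A = adjacencyMatrix K (specialUnitGraph 𝔽)

  -- For complex values `dual` would be the conjugate of `wave`; χ at the negated matrix expresses
  -- it without conjugation.
  wave dual : Fin n → Vector Carrier n
  wave j i = χ ⟨ Γ.vertex j , Γ.vertex i ⟩
  dual j i = χ ⟨ Γ.vertex j Mat.⁻¹ , Γ.vertex i ⟩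

  wave-symmetric : ∀ i j → wave i j ≈ wave j i
  wave-symmetric i j = χ-cong (⟨⟩-comm (Γ.vertex i) (Γ.vertex j))

  dual-symmetric : ∀ i j → dual i j ≈ dual j i
  dual-symmetric i j = χ-cong (F.trans (⟨⟩-⁻¹ (Γ.vertex i) (Γ.vertex j)) (⟨⟩-comm (Γ.vertex i) (Γ.vertex j Mat.⁻¹)))

  vertex-injective : ∀ {i j} → Γ.vertex i Mat.≈ Γ.vertex j → i ≡ j
  vertex-injective eq = ≡.trans (≡.sym (Inverse.inverseˡ Γ.enumeration Mat.refl))
    (≡.trans (Inverse.to-cong Γ.enumeration eq) (Inverse.inverseˡ Γ.enumeration Mat.refl))

  wave-dual : ∀ j k → sum {n} (λ i → wave j i * dual k i) ≈ Q ^ 4 * 𝟙 (j Finₚ.≟ k)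
  wave-dual j k = trans (reflexive (≡.sym (∑M.∑-sum _)))
    (trans (orthogonality (Γ.vertex j) (Γ.vertex k))
      (*-congˡ (𝟙-⇔ (Γ.vertex j ≟M Γ.vertex k) (j Finₚ.≟ k) vertex-injective
        λ j≡k → Mat.reflexive (≡.cong Γ.vertex j≡k))))

  wave-eigenvector : ∀ j → Eigenspace A (eigenvalue (Γ.vertex j)) (wave j)
  wave-eigenvector j i = trans (reflexive (≡.sym (∑M.∑-sum _))) (adjacency-χ (Γ.vertex j) (Γ.vertex i))

  open DualBases K wave dual (^-≉0 4 Q≉0) wave-dual
    -- Both families are symmetric as matrices, so the column relations are the row relations.
    (λ i k → trans (sum-cong {n} λ j → *-cong (wave-symmetric j i) (dual-symmetric j k)) (wave-dual i k))
  open Eigenbasis K A (eigenvalue ∘ Γ.vertex) wave wave-eigenvector spanning independent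

  hasSpectrum : HasSpectrum A spectrum
  hasSpectrum = length≡n , λ x →
    ≡.subst (HasDimension (Eigenspace A x)) (count≡occurrences x) (eigenspace-dimension x)
    where
    length≡n : length spectrum ≡ n
    length≡n = fromℕ-injective _ _ (begin
      fromℕ (length spectrum)       ≈⟨ fromℕ-length spectrum ⟩
      sumOver spectrum (λ _ → 1#)   ≈⟨ sumOver-spectrum (λ _ → 1#) (λ _ → refl) ⟩
      ∑M (λ _ → 1#)                 ≈⟨ ∑M.∑-const 1# ⟩
      fromℕ n                       ∎)
    count≡occurrences : ∀ x → length (filter (λ j → x ≟ eigenvalue (Γ.vertex j)) (allFin n)) ≡ occurrences x spectrum
    count≡occurrences x = fromℕ-injective _ _ (begin
      fromℕ (length (filter (λ j → x ≟ eigenvalue (Γ.vertex j)) (allFin n)))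
        ≈⟨ fromℕ-length (filter (λ j → x ≟ eigenvalue (Γ.vertex j)) (allFin n)) ⟩
      sumOver (filter (λ j → x ≟ eigenvalue (Γ.vertex j)) (allFin n)) (λ _ → 1#)
        ≈⟨ sum-filter-allFin (λ j → x ≟ eigenvalue (Γ.vertex j)) (λ _ → 1#) ⟩
      sum {n} (λ j → 𝟙 (x ≟ eigenvalue (Γ.vertex j)) * 1#)
        ≡⟨ ∑M.∑-sum _ ⟨
      ∑M (λ M → 𝟙 (x ≟ eigenvalue M) * 1#)
        -- The test function is the indicator of x, which collects equal entries coming from
        -- different δ.
        ≈⟨ sumOver-spectrum (λ y → 𝟙 (x ≟ y) * 1#) (λ {y} {z} y≈z → *-congʳ
             (𝟙-⇔ (x ≟ y) (x ≟ z) (λ eq → trans eq y≈z) (λ eq → trans eq (sym y≈z)))) ⟨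
      sumOver spectrum (λ y → 𝟙 (x ≟ y) * 1#)
        ≈⟨ sumOver-filter (x ≟_) spectrum (λ _ → 1#) ⟨
      sumOver (filter (x ≟_) spectrum) (λ _ → 1#)
        ≈⟨ fromℕ-length (filter (x ≟_) spectrum) ⟨
      fromℕ (occurrences x spectrum) ∎)

theorem3p12 : ∀ {a ℓ₁ c ℓ₂} (𝔽 : FiniteField a ℓ₁) (ℂ : ComplexExponential c ℓ₂) →
    let
    module F = FiniteField 𝔽
    open ComplexExponential ℂ
    open LinearAlgebra baseField
    q = F.q
    χ = canonicalCharacter 𝔽 ℂ
    μ = λ δ → fromℕ q * sumOver F.nonzeroElements (λ α → χ (α F.+ δ F.* α F.⁻¹))
    in
    HasSpectrum (adjacencyMatrix baseField (specialUnitGraph 𝔽))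
    ( (fromℕ q ^ 3 - fromℕ q)
    ∷ replicate (q ^ℕ 3 +ℕ q ^ℕ 2 ∸ q ∸ 1) (- fromℕ q)
    ++ concatMap (λ δ → replicate (q ^ℕ 3 ∸ q) (μ δ)) F.nonzeroElements )
theorem3p12 𝔽 ℂ = Fourier.hasSpectrum 𝔽 baseField characteristicZero (canonicalAdditiveCharacter 𝔽 ℂ)
  where open ComplexExponential ℂ
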